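{- Let $s\ge 3$ be even and let $L(x_1,\dots,x_s)=c_1x_1+\dots+c_sx_s$ be a translation-invariant linear form (that is, $c_i\in\mathbb{Z}\setminus\{0\}$ and $c_1+\dots+c_s=0$) that is primitive. If the integer \[ (-1)^{s/2}\prod_{i=1}^s c_i \] is not a perfect square, then \[ r_L(N)=\Omega_L\left(N^{\frac1{s-2}}\right), \] i.e. there is a constant $C>0$ depending only on $L$ such that $r_L(N)\ge C\,N^{1/(s-2)}$ for all integers $N\ge1$.
   Context: A form $L(x_1,\dots,x_s)=\sum_i c_ix_i$ with $c_i\in\mathbb{Z}\setminus\{0\}$, $\sum_i c_i=0$, is primitive if, among the partitions $\mathcal T$ of $[s]=\{1,\dots,s\}$ satisfying $\sum_{i\in T}c_i=0$ for all $T\in\mathcal T$, there is a unique finest one (i.e. a unique one minimal under refinement; equivalently, one that refines all the others). For a solution $(x_1,\dots,x_s)\in\mathbb{Z}^s$ to $L=0$, let $\mathcal T$ be the partition of $[s]$ in which $i,j$ lie in the same block if and only if $x_i=x_j$. The solution is trivial if $\sum_{i\in T}c_i=0$ for all $T\in\mathcal T$, and nontrivial otherwise. A set $A\subseteq\mathbb{Z}$ is $L$-free if all solutions in $A^s$ to $L=0$ are trivial. Define $r_L(N)=\max\{|A| : A\subseteq\{1,\dots,N\} \text{ is } L\text{ -free}\}$. -}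

module Defs where

open import Algebra.Definitions.RawMonoid using (sum)
open import Data.Bool.Base using (if_then_else_)
open import Data.Fin.Base using (Fin; zero; suc; toℕ)
open import Data.Fin.Properties using (all?)
open import Data.Fin.Subset using (Subset; _∈_; _⊆_; Nonempty; ∣_∣) renaming (⊥ to ∅)
open import Data.Fin.Subset.Properties using (_∈?_; anySubset?; ∣p∣≤n; ∣⊥∣≡0; ∉⊥)
open import Data.Integer.Base using (ℤ; +_; 0ℤ; _*_; +-0-rawMonoid; *-1-rawMonoid)
import Data.Integer.Base as ℤ
import Data.Integer.Properties as ℤ
open import Data.Nat.Base using (ℕ; zero; suc; _≤_; s≤s⁻¹)
import Data.Nat.Properties as ℕ
open import Data.Product using (∃; ∃!; _×_; _,_; proj₁; proj₂)
open import Data.Rational.Base as ℚ using (ℚ)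
open import Data.Vec.Base using (Vec; []; _∷_; lookup; tabulate)
open import Data.Vec.Properties using (lookup∘tabulate; tabulate-cong; lookup⇒[]=; []=⇒lookup)
open import Function.Base using (_∘_)
open import Function.Bundles using (_⇔_)
open import Level using (0ℓ)
open import Relation.Binary.PropositionalEquality using (_≡_; _≗_; refl; sym; trans; cong; cong₂; subst)
open import Relation.Nullary using (Dec; yes; no; does; contradiction)
open import Relation.Nullary.Decidable using (map′; dec-true; _×-dec_; _→-dec_)
open import Relation.Unary using (Pred; Decidable)

sumℤ : ∀ {n} → (Fin n → ℤ) → ℤ
sumℤ = sum +-0-rawMonoid

prodℤ : ∀ {n} → (Fin n → ℤ) → ℤ
prodℤ = sum *-1-rawMonoid

sumOver : ∀ {n} → Subset n → (Fin n → ℤ) → ℤ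
sumOver T c = sumℤ λ i → if lookup T i then c i else 0ℤ

IsPerfectSquare : ℤ → Set
IsPerfectSquare n = ∃ λ k → n ≡ k * k

record Partition (s : ℕ) : Set₁ where
  field
    Block    : Pred (Subset s) 0ℓ
    nonempty : ∀ {T} → Block T → Nonempty T
    covers   : ∀ i → ∃! _≡_ λ T → Block T × i ∈ T

open Partition public

module _ {s : ℕ} where

  _Refines_ : Partition s → Partition s → Set
  𝒯 Refines 𝒰 = ∀ T → Block 𝒯 T → ∃ λ U → Block 𝒰 U × T ⊆ U

  _≈ₚ_ : Partition s → Partition s → Set
  𝒯 ≈ₚ 𝒰 = ∀ T → Block 𝒯 T ⇔ Block 𝒰 T

  ZeroSum : (Fin s → ℤ) → Partition s → Set
  ZeroSum c 𝒯 = ∀ T → Block 𝒯 T → sumOver T c ≡ 0ℤ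

  Finest : (Fin s → ℤ) → Partition s → Set₁
  Finest c 𝒯 = ZeroSum c 𝒯 × (∀ 𝒰 → ZeroSum c 𝒰 → 𝒰 Refines 𝒯 → 𝒰 ≈ₚ 𝒯)

  Primitive : (Fin s → ℤ) → Set₁
  Primitive c = ∃! _≈ₚ_ (Finest c)

  linearForm : (Fin s → ℤ) → (Fin s → ℤ) → ℤ
  linearForm c x = sumℤ λ i → c i * x i

  levelSet : (Fin s → ℤ) → Fin s → Subset s
  levelSet x i = tabulate λ j → does (x i ℤ.≟ x j)

  ∈-levelSet⁺ : ∀ x {i j} → x i ≡ x j → j ∈ levelSet x i
  ∈-levelSet⁺ x {i} {j} eq =
    lookup⇒[]= j _ (trans (lookup∘tabulate _ j) (dec-true (x i ℤ.≟ x j) eq))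

  ∈-levelSet⁻ : ∀ x {i j} → j ∈ levelSet x i → x i ≡ x j
  ∈-levelSet⁻ x {i} {j} j∈
    with x i ℤ.≟ x j | trans (sym (lookup∘tabulate (λ k → does (x i ℤ.≟ x k)) j)) ([]=⇒lookup j∈)
  ... | yes eq | _  = eq
  ... | no  _  | ()

  levelPartition : (Fin s → ℤ) → Partition s
  levelPartition x = record
    { Block    = λ T → ∃ λ i → T ≡ levelSet x i
    ; nonempty = λ { (i , refl) → i , ∈-levelSet⁺ x refl }
    ; covers   = λ i → levelSet x i , ((i , refl) , ∈-levelSet⁺ x refl) , λ where
        ((k , refl) , i∈) → tabulate-cong λ j →
          cong (λ a → does (a ℤ.≟ x j)) (sym (∈-levelSet⁻ x i∈))
    }

  Trivial : (Fin s → ℤ) → (Fin s → ℤ) → Set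
  Trivial c x = ZeroSum c (levelPartition x)

  LFree : (Fin s → ℤ) → Pred ℤ 0ℓ → Set
  LFree c A = ∀ x → (∀ i → A (x i)) → linearForm c x ≡ 0ℤ → Trivial c x

-- A subset of {1,…,N} is encoded as a Subset N, with k : Fin N standing for
-- the integer toℕ k + 1.
element : ∀ {N} → Fin N → ℤ
element k = + suc (toℕ k)

⟦_⟧ : ∀ {N} → Subset N → Pred ℤ 0ℓ
⟦ A ⟧ z = ∃ λ k → k ∈ A × z ≡ element k

IsMaxSize : ∀ {s} → (Fin s → ℤ) → ℕ → ℕ → Set
IsMaxSize c N r =
  (∃ λ (A : Subset N) → LFree c ⟦ A ⟧ × ∣ A ∣ ≡ r) ×
  (∀ (A : Subset N) → LFree c ⟦ A ⟧ → ∣ A ∣ ≤ r)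

sumℤ-cong : ∀ {n} {f g : Fin n → ℤ} → f ≗ g → sumℤ f ≡ sumℤ g
sumℤ-cong {zero}  eq = refl
sumℤ-cong {suc n} eq = cong₂ ℤ._+_ (eq zero) (sumℤ-cong (eq ∘ suc))

allVec? : ∀ {N} s {P : Pred (Vec (Fin N) s) 0ℓ} → Decidable P → Dec (∀ v → P v)
allVec? zero    P? = map′ (λ { p [] → p }) (λ p → p []) (P? [])
allVec? (suc s) P? =
  map′ (λ { p (k ∷ v) → p k v }) (λ p k v → p (k ∷ v))
       (all? λ k → allVec? s λ v → P? (k ∷ v))

module _ {s : ℕ} (c : Fin s → ℤ) where

  trivial? : ∀ x → Dec (Trivial c x)
  trivial? x = map′ (λ { p _ (i , refl) → p i }) (λ p i → p _ (i , refl))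
                    (all? λ i → sumOver (levelSet x i) c ℤ.≟ 0ℤ)

  trivial-resp : ∀ {x y} → x ≗ y → Trivial c x → Trivial c y
  trivial-resp eq p _ (i , refl) =
    trans (cong (λ T → sumOver T c)
                (tabulate-cong λ j → cong₂ (λ a b → does (a ℤ.≟ b)) (sym (eq i)) (sym (eq j))))
          (p _ (i , refl))

  lfree? : ∀ {N} (A : Subset N) → Dec (LFree c ⟦ A ⟧)
  lfree? {N} A = map′ to from (allVec? s λ v →
      all? (λ i → lookup v i ∈? A)
      →-dec ((linearForm c (element ∘ lookup v) ℤ.≟ 0ℤ)
      →-dec trivial? (element ∘ lookup v)))
    where
    Q : Vec (Fin N) s → Set
    Q v = (∀ i → lookup v i ∈ A) → linearForm c (element ∘ lookup v) ≡ 0ℤ →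
          Trivial c (element ∘ lookup v)

    to : (∀ v → Q v) → LFree c ⟦ A ⟧
    to q x x∈ Lx≡0 = trivial-resp eq (q v
        (λ i → subst (_∈ A) (sym (lookup∘tabulate _ i)) (proj₁ (proj₂ (x∈ i))))
        (trans (sumℤ-cong λ i → cong (c i *_) (eq i)) Lx≡0))
      where
      v : Vec (Fin N) s
      v = tabulate (proj₁ ∘ x∈)
      eq : element ∘ lookup v ≗ x
      eq i = trans (cong element (lookup∘tabulate (proj₁ ∘ x∈) i)) (sym (proj₂ (proj₂ (x∈ i))))

    from : LFree c ⟦ A ⟧ → ∀ v → Q v
    from f v v∈ = f (element ∘ lookup v) (λ i → lookup v i , v∈ i , refl)

  ∅-lfree : ∀ {N} → LFree c ⟦ ∅ {N} ⟧
  ∅-lfree x x∈ _ _ (i , _) = contradiction (proj₁ (proj₂ (x∈ i))) ∉⊥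

  maxSize : ∀ N → ∃ (IsMaxSize c N)
  maxSize N = search N (λ A _ → ∣p∣≤n A)
    where
    search : ∀ b → (∀ (A : Subset N) → LFree c ⟦ A ⟧ → ∣ A ∣ ≤ b) → ∃ (IsMaxSize c N)
    search zero    bound = 0 , (∅ , ∅-lfree , ∣⊥∣≡0 N) , bound
    search (suc b) bound with anySubset? (λ A → lfree? A ×-dec (∣ A ∣ ℕ.≟ suc b))
    ... | yes found = suc b , found , bound
    ... | no  none  = search b λ A free →
      s≤s⁻¹ (ℕ.≤∧≢⇒< (bound A free) λ eq → none (A , free , eq))

  r : ℕ → ℕ
  r N = proj₁ (maxSize N)

fromℕ : ℕ → ℚ
fromℕ n = + n ℚ./ 1

open import Algebra.Definitions.RawSemiring ℚ.+-*-rawSemiring public using () renaming (_^_ to _^ℚ_)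

-- x ≥ C · y^(1/d) for x, y ≥ 0, C > 0 and d ≥ 1, with the root cleared by
-- raising both (nonnegative) sides to the power d.
_≥_·_^1/_ : ℕ → ℚ → ℕ → ℕ → Set
x ≥ C · y ^1/ d = (C ^ℚ d) ℚ.* fromℕ y ℚ.≤ fromℕ x ^ℚ d

{-# OPTIONS --safe #-}
module Submission where

-- Put d = s − 2 and n = (−1)^(s/2) ∏ cᵢ.  Let p be a large prime modulo which
-- n is not a square, and let Σᵢ cᵢ xᵢʲ ≡ 0 (mod p) for 0 ≤ j ≤ d.  If the xᵢ
-- take at most s − 1 values modulo p, Vandermonde shows that the coefficients
-- on each level set sum to 0.  If they are distinct, then cᵢ ∏_{k ≠ i} (xᵢ − xₖ)
-- does not depend on i, and multiplying over i exhibits n as a square modulo p.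
-- Primitivity makes this compatible with the Chinese remainder theorem: if m is
-- a product of distinct such primes, solutions modulo m are constant on the
-- blocks of the finest zero-sum partition.  Hence the numbers with base-M digits
-- x, x², …, x^d reduced modulo m, where M ≈ m Σ|cᵢ|, form an L-free set of size m
-- in [1, M^d].
--
-- Such m exist at every scale up to a constant factor as soon as there is K such
-- that each P has an admissible prime p ∤ P with p ≤ K P.  This is Euclid's
-- argument: take u in a fixed residue class with Jacobi symbol (n/u) = −1,
-- coprime to P and of size O(P).  The Jacobi symbol is handled through the
-- Gauss–Schering sign ε, which is multiplicative in the numerator (so squares
-- have sign 1) and periodic in the modulus u with period 4a.

open import Defs
open import Algebra.Bundles using (CommutativeMonoid)
open import Data.Bool.Base using (Bool; true; false; if_then_else_; _xor_)
open import Data.Empty using (⊥; ⊥-elim)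
open import Data.Fin.Base using (Fin; zero; suc; toℕ; fromℕ<; punchIn; punchOut)
import Data.Fin.Properties as Fin
open import Data.Fin.Permutation using (Permutation; permutation)
open import Data.Fin.Subset using (Subset; _∈_; _∉_; _⊆_; _∩_; _∪_; ∁; ⁅_⁆; ∣_∣; inside; outside) renaming (⊥ to ∅)
import Data.Fin.Subset.Properties as Sub
open import Data.Integer.Base using (ℤ; +_; -[1+_]; 0ℤ; 1ℤ; -1ℤ; _+_; _-_; -_; _*_; _^_)
import Data.Integer.Base as ℤ
import Data.Integer.DivMod as ℤ
open import Data.Integer.Divisibility.Signed using (divides; ∣ᵤ⇒∣; ∣⇒∣ᵤ) renaming (_∣_ to _∣ℤ_; _∣?_ to _∣ℤ?_)
import Data.Integer.Divisibility.Signed as ∣ℤ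
import Data.Integer.Properties as ℤ
open import Data.Integer.Tactic.RingSolver using (solve-∀)
open import Data.List.Base using (List)
open import Data.List.Relation.Unary.All using (All; []; _∷_)
open import Data.Nat.Base using (ℕ; zero; suc; _≤_; _<_; _∸_; _/_; z≤n; s≤s)
import Data.Nat.Base as ℕ
open import Data.Nat.Coprimality using (Coprime; coprime-Bézout; gcd≡1⇒coprime)
open import Data.Nat.Divisibility using (_∣_)
import Data.Nat.Divisibility as ∣
import Data.Nat.DivMod as ℕ
open import Data.Nat.GCD using (module Bézout; gcd; gcd[m,n]∣m; gcd[m,n]∣n)
open import Data.Nat.Induction using (Acc; acc; <-wellFounded)
open import Data.Nat.ListAction using (product)
open import Data.Nat.Primality using (Prime)
import Data.Nat.Primality as Prime
open import Data.Nat.Primality.Factorisation using (PrimeFactorisation; factorise)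
import Data.Nat.Properties as ℕ
import Data.Nat.Tactic.RingSolver as ℕSolver
open import Data.Product using (∃; ∃₂; _×_; _,_; proj₁; proj₂)
open import Data.Rational.Base using (ℚ; Positive)
import Data.Rational.Base as ℚ
open import Data.Rational.Literals using (fromℤ)
import Data.Rational.Properties as ℚ
open import Data.Sum.Base using (_⊎_; inj₁; inj₂; [_,_]′)
open import Data.Vec.Base using ([]; _∷_; here; there; lookup)
open import Data.Vec.Properties using (lookup∘tabulate)
open import Function.Base using (_∘_; _$_)
open import Function.Bundles using (Equivalence; mk⇔)
open import Relation.Binary.PropositionalEquality using (_≡_; _≢_; refl; sym; trans; cong; cong₂; subst; subst₂; module ≡-Reasoning)
open import Relation.Nullary using (¬_; Dec; yes; no; does; contradiction)
open import Relation.Nullary.Decidable using (dec-true; dec-false; decidable-stable; does-⇔; ¬?; _×-dec_)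
import Algebra.Properties.CommutativeMonoid.Sum ℤ.*-1-commutativeMonoid as Π
import Algebra.Properties.CommutativeMonoid.Sum ℤ.+-0-commutativeMonoid as Σ
open import Algebra.Properties.CommutativeSemigroup (CommutativeMonoid.commutativeSemigroup ℚ.*-1-commutativeMonoid) using (interchange)

-- Congruences and coprimality

-- Exponents up to s - 2 are one short of a full Vandermonde system. At distinct points the possible
-- coefficients therefore form a line modulo p, spanned by the reciprocals of ∏_{k ≠ i} (xᵢ - xₖ),
-- and ∏ᵢ cᵢ times ∏ᵢ ∏_{k ≠ i} (xᵢ - xₖ) is an s-th power. Pairing (i, k) with (k, i) turns the
-- double product into a square with sign (-1)^(s(s-1)/2), which for even s is (-1)^(s/2).
--
-- The obstacle is composite m: reductions modulo two primes may be trivial along different zero-sum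
-- partitions, whose common refinement need not be zero-sum. A unique finest partition refines all
-- of them, so residues are constant on its blocks modulo every prime at once.
--
-- Composite m are needed because Euclid's argument bounds the new prime only from above, by K P.
-- That u has an admissible prime factor is seen by contraposition: otherwise n is a square modulo
-- each prime factor, by lifting also modulo u, and its sign is 1. If -n is not a square, the class
-- of u comes from a modulus at which a prime q of odd exponent in n has sign -1; for q ≡ 1 (mod 4)
-- finding it is an instance of reciprocity.

infix 4 _≋_[_]

record _≋_[_] (a b u : ℤ) : Set where
  constructor mod
  field difference : u ∣ℤ a - b

open _≋_[_] public

module _ {u : ℤ} where

  ≋-reflexive : ∀ {a b} → a ≡ b → a ≋ b [ u ]
  ≋-reflexive {a} refl = mod (divides 0ℤ (ℤ.+-inverseʳ a))

  ≋-refl : ∀ {a} → a ≋ a [ u ]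
  ≋-refl = ≋-reflexive refl

  ≋-sym : ∀ {a b} → a ≋ b [ u ] → b ≋ a [ u ]
  ≋-sym {a} {b} (mod (divides k eq)) = mod $ divides (- k) $ begin
    b - a      ≡⟨ lemma a b ⟩
    - (a - b)  ≡⟨ cong -_ eq ⟩
    - (k * u)  ≡⟨ ℤ.neg-distribˡ-* k u ⟩
    - k * u    ∎
    where
    open ≡-Reasoning
    lemma : ∀ a b → b - a ≡ - (a - b)
    lemma = solve-∀

  ≋-trans : ∀ {a b c} → a ≋ b [ u ] → b ≋ c [ u ] → a ≋ c [ u ]
  ≋-trans {a} {b} {c} (mod p) (mod q) =
    mod (subst (u ∣ℤ_) (lemma a b c) (∣ℤ.∣m∣n⇒∣m+n p q))
    where
    lemma : ∀ a b c → (a - b) + (b - c) ≡ a - c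
    lemma = solve-∀

  +-mod : ∀ {a b c d} → a ≋ b [ u ] → c ≋ d [ u ] → a + c ≋ b + d [ u ]
  +-mod {a} {b} {c} {d} (mod p) (mod q) =
    mod (subst (u ∣ℤ_) (lemma a b c d) (∣ℤ.∣m∣n⇒∣m+n p q))
    where
    lemma : ∀ a b c d → (a - b) + (c - d) ≡ (a + c) - (b + d)
    lemma = solve-∀

  *-mod : ∀ {a b c d} → a ≋ b [ u ] → c ≋ d [ u ] → a * c ≋ b * d [ u ]
  *-mod {a} {b} {c} {d} (mod p) (mod q) =
    mod (subst (u ∣ℤ_) (lemma a b c d) (∣ℤ.∣m∣n⇒∣m+n (∣ℤ.∣m⇒∣m*n c p) (∣ℤ.∣n⇒∣m*n b q)))
    where
    lemma : ∀ a b c d → (a - b) * c + b * (c - d) ≡ a * c - b * d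
    lemma = solve-∀

  *-modˡ : ∀ a {b c} → b ≋ c [ u ] → a * b ≋ a * c [ u ]
  *-modˡ a = *-mod (≋-refl {a})

  *-modʳ : ∀ c {a b} → a ≋ b [ u ] → a * c ≋ b * c [ u ]
  *-modʳ c p = *-mod p (≋-refl {c})

  ^-mod : ∀ {a b} k → a ≋ b [ u ] → a ^ k ≋ b ^ k [ u ]
  ^-mod zero    p = ≋-refl
  ^-mod (suc k) p = *-mod p (^-mod k p)

  sum-mod : ∀ {n} {f g : Fin n → ℤ} → (∀ i → f i ≋ g i [ u ]) → sumℤ f ≋ sumℤ g [ u ]
  sum-mod {zero}  p = ≋-refl
  sum-mod {suc n} p = +-mod (p zero) (sum-mod (p ∘ suc))

  prod-mod : ∀ {n} {f g : Fin n → ℤ} → (∀ i → f i ≋ g i [ u ]) → prodℤ f ≋ prodℤ g [ u ]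
  prod-mod {zero}  p = ≋-refl
  prod-mod {suc n} p = *-mod (p zero) (prod-mod (p ∘ suc))

  ∣⇒≋0 : ∀ {a} → u ∣ℤ a → a ≋ 0ℤ [ u ]
  ∣⇒≋0 {a} p = mod (subst (u ∣ℤ_) (sym (ℤ.+-identityʳ a)) p)

  ≋0⇒∣ : ∀ {a} → a ≋ 0ℤ [ u ] → u ∣ℤ a
  ≋0⇒∣ {a} (mod p) = subst (u ∣ℤ_) (ℤ.+-identityʳ a) p

  ≋-multiple : ∀ a k → a + k * u ≋ a [ u ]
  ≋-multiple a k = mod (divides k (lemma a (k * u)))
    where
    lemma : ∀ a b → a + b - a ≡ b
    lemma = solve-∀

mod-∣ : ∀ {u v a b} → v ∣ℤ u → a ≋ b [ u ] → a ≋ b [ v ]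
mod-∣ v∣u (mod p) = mod (∣ℤ.∣-trans v∣u p)

%ℕ-mod : ∀ a u .{{_ : ℕ.NonZero u}} → + (a ℤ.%ℕ u) ≋ a [ + u ]
%ℕ-mod a u = ≋-sym (≋-trans (≋-reflexive (ℤ.a≡a%ℕn+[a/ℕn]*n a u)) (≋-multiple _ (a ℤ./ℕ u)))

∣-small⇒≡0 : ∀ {u a} → + u ∣ℤ a → ℤ.∣ a ∣ < u → a ≡ 0ℤ
∣-small⇒≡0 {u} {a} p a<u with ℤ.∣ a ∣ in eq | ∣⇒∣ᵤ p
... | zero  | _ = ℤ.∣i∣≡0⇒i≡0 eq
... | suc k | q = contradiction (∣.∣⇒≤ q) (ℕ.<⇒≱ a<u)

≋-small⇒≡ : ∀ {u x y} → x < u → y < u → + x ≋ + y [ + u ] → x ≡ y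
≋-small⇒≡ {u} {x} {y} x<u y<u (mod p) =
  ℤ.+-injective (ℤ.i-j≡0⇒i≡j (+ x) (+ y) (∣-small⇒≡0 p bound))
  where
  bound : ℤ.∣ + x - + y ∣ < u
  bound rewrite ℤ.m-n≡m⊖n x y = ℕ.≤-<-trans (ℤ.∣m⊝n∣≤m⊔n x y) (ℕ.⊔-lub x<u y<u)

-- Coprimality of integers by a Bézout certificate, so that its closure
-- properties are ring identities.
infix 4 _⟂_

record _⟂_ (a b : ℤ) : Set where
  constructor bézout
  field
    coeffˡ coeffʳ : ℤ
    identity      : coeffˡ * a + coeffʳ * b ≡ 1ℤ

⟂-sym : ∀ {a b} → a ⟂ b → b ⟂ a
⟂-sym {a} {b} (bézout x y eq) = bézout y x (trans (ℤ.+-comm (y * b) (x * a)) eq)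

⟂-* : ∀ {a b c} → a ⟂ b → a ⟂ c → a ⟂ (b * c)
⟂-* {a} {b} {c} (bézout x y p) (bézout z w q) =
  bézout (x * (z * a + w * c) + y * b * z) (y * w)
    (trans (lemma a b c x y z w) (cong₂ _*_ p q))
  where
  lemma : ∀ a b c x y z w →
    (x * (z * a + w * c) + y * b * z) * a + y * w * (b * c) ≡ (x * a + y * b) * (z * a + w * c)
  lemma = solve-∀

⟂-*⁻ : ∀ {a} b {c} → a ⟂ (b * c) → a ⟂ c
⟂-*⁻ {a} b {c} (bézout x y p) = bézout x (y * b) (trans (cong (λ t → x * a + t) (ℤ.*-assoc y b c)) p)

⟂-∣ : ∀ {a b c} → b ∣ℤ c → a ⟂ c → a ⟂ b
⟂-∣ {a} {b} (divides q refl) p = ⟂-*⁻ q p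

⟂-neg : ∀ {a b} → a ⟂ b → a ⟂ (- b)
⟂-neg {a} {b} (bézout x y p) = bézout x (- y) (trans (lemma x a y b) p)
  where
  lemma : ∀ x a y b → x * a + - y * - b ≡ x * a + y * b
  lemma = solve-∀

⟂-mod : ∀ {u a b} → a ≋ b [ u ] → u ⟂ a → u ⟂ b
⟂-mod {u} {a} {b} (mod (divides k eq)) (bézout x y p) = bézout (x + y * k) y $ begin
  (x + y * k) * u + y * b      ≡⟨ lemma x y k u b ⟩
  x * u + y * (k * u + b)      ≡⟨ cong (λ t → x * u + y * (t + b)) (sym eq) ⟩
  x * u + y * ((a - b) + b)    ≡⟨ lemma′ x y u a b ⟩
  x * u + y * a                ≡⟨ p ⟩
  1ℤ                           ∎
  where
  open ≡-Reasoning
  lemma : ∀ x y k u b → (x + y * k) * u + y * b ≡ x * u + y * (k * u + b)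
  lemma = solve-∀
  lemma′ : ∀ x y u a b → x * u + y * ((a - b) + b) ≡ x * u + y * a
  lemma′ = solve-∀

⟂-1 : ∀ a → a ⟂ 1ℤ
⟂-1 a = bézout 0ℤ 1ℤ (cong (_+ 1ℤ) (ℤ.*-zeroˡ a))

⟂-inverse : ∀ {u a} → u ⟂ a → ∃ λ b → b * a ≋ 1ℤ [ u ]
⟂-inverse {u} {a} (bézout x y p) = y , mod (divides (- x) (begin
  y * a - 1ℤ               ≡⟨ cong (λ t → y * a - t) (sym p) ⟩
  y * a - (x * u + y * a)  ≡⟨ lemma y a x u ⟩
  - x * u                  ∎))
  where
  open ≡-Reasoning
  lemma : ∀ y a x u → y * a - (x * u + y * a) ≡ - x * u
  lemma = solve-∀

inverse-⟂ : ∀ {u} a b → b * a ≋ 1ℤ [ u ] → u ⟂ a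
inverse-⟂ {u} a b (mod (divides k eq)) = bézout (- k) b (begin
  - k * u + b * a             ≡⟨ lemma k u (b * a) ⟩
  b * a - k * u               ≡⟨ cong (λ t → b * a - t) (sym eq) ⟩
  b * a - (b * a - 1ℤ)        ≡⟨ lemma′ (b * a) ⟩
  1ℤ                          ∎)
  where
  open ≡-Reasoning
  lemma : ∀ k u z → - k * u + z ≡ z - k * u
  lemma = solve-∀
  lemma′ : ∀ z → z - (z - 1ℤ) ≡ 1ℤ
  lemma′ = solve-∀

⟂-cancelˡ : ∀ {u a x y} → u ⟂ a → a * x ≋ a * y [ u ] → x ≋ y [ u ]
⟂-cancelˡ {u} {a} {x} {y} u⟂a p with ⟂-inverse u⟂a
... | b , ba≋1 = ≋-trans (≋-sym (expand x)) (≋-trans (*-modˡ b p) (expand y))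
  where
  expand : ∀ z → b * (a * z) ≋ z [ u ]
  expand z = ≋-trans (≋-reflexive (sym (ℤ.*-assoc b a z)))
               (≋-trans (*-modʳ z ba≋1) (≋-reflexive (ℤ.*-identityˡ z)))

⟂-*-∣ : ∀ {a b x} → a ⟂ b → a ∣ℤ x → b ∣ℤ x → (a * b) ∣ℤ x
⟂-*-∣ {a} {b} {x} (bézout y z p) (divides k refl) (divides l eq) = divides (y * l + z * k) (begin
  k * a                               ≡⟨ sym (ℤ.*-identityʳ (k * a)) ⟩
  k * a * 1ℤ                          ≡⟨ cong (λ t → k * a * t) (sym p) ⟩
  k * a * (y * a + z * b)             ≡⟨ lemma k a y z b ⟩
  y * a * (k * a) + z * k * (a * b)   ≡⟨ cong (λ t → y * a * t + z * k * (a * b)) eq ⟩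
  y * a * (l * b) + z * k * (a * b)   ≡⟨ lemma′ k a y z b l ⟩
  (y * l + z * k) * (a * b)           ∎)
  where
  open ≡-Reasoning
  lemma : ∀ k a y z b → k * a * (y * a + z * b) ≡ y * a * (k * a) + z * k * (a * b)
  lemma = solve-∀
  lemma′ : ∀ k a y z b l → y * a * (l * b) + z * k * (a * b) ≡ (y * l + z * k) * (a * b)
  lemma′ = solve-∀

Coprime⇒⟂ : ∀ {m n} → Coprime m n → + m ⟂ + n
Coprime⇒⟂ {m} {n} c with coprime-Bézout c
... | Bézout.+- x y eq = bézout (+ x) (- + y) (begin
  + x * + m + - + y * + n        ≡⟨ cong (λ t → t + - + y * + n) (sym (ℤ.pos-* x m)) ⟩
  + (x ℕ.* m) + - + y * + n      ≡⟨ cong (λ t → + t + - + y * + n) (sym eq) ⟩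
  + (1 ℕ.+ y ℕ.* n) + - + y * + n ≡⟨ cong (λ t → 1ℤ + t + - + y * + n) (ℤ.pos-* y n) ⟩
  1ℤ + + y * + n + - + y * + n   ≡⟨ lemma (+ y) (+ n) ⟩
  1ℤ                             ∎)
  where
  open ≡-Reasoning
  lemma : ∀ y n → 1ℤ + y * n + - y * n ≡ 1ℤ
  lemma = solve-∀
... | Bézout.-+ x y eq = bézout (- + x) (+ y) (begin
  - + x * + m + + y * + n         ≡⟨ cong (λ t → - + x * + m + t) (sym (ℤ.pos-* y n)) ⟩
  - + x * + m + + (y ℕ.* n)       ≡⟨ cong (λ t → - + x * + m + + t) (sym eq) ⟩
  - + x * + m + + (1 ℕ.+ x ℕ.* m) ≡⟨ cong (λ t → - + x * + m + (1ℤ + t)) (ℤ.pos-* x m) ⟩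
  - + x * + m + (1ℤ + + x * + m)  ≡⟨ lemma (+ x) (+ m) ⟩
  1ℤ                              ∎)
  where
  open ≡-Reasoning
  lemma : ∀ x m → - x * m + (1ℤ + x * m) ≡ 1ℤ
  lemma = solve-∀

prime-∤⇒⟂ : ∀ {p a} → Prime p → ¬ (+ p ∣ℤ a) → + p ⟂ a
prime-∤⇒⟂ {p} {a} pp p∤a = from-abs a (Coprime⇒⟂ (prime⇒coprime′ ℤ.∣ a ∣ (p∤a ∘ ∣ᵤ⇒∣)))
  where
  prime⇒coprime′ : ∀ m → ¬ (p ∣ m) → Coprime p m
  prime⇒coprime′ m p∤m {d} (d∣p , d∣m) with Prime.prime⇒irreducible pp d∣p
  ... | inj₁ refl = refl
  ... | inj₂ refl = contradiction d∣m p∤m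
  from-abs : ∀ a → + p ⟂ + ℤ.∣ a ∣ → + p ⟂ a
  from-abs (+ _)      c = c
  from-abs (-[1+ _ ]) c = ⟂-neg c

⟂-prime-∤ : ∀ {p a} → Prime p → + p ⟂ a → ¬ (+ p ∣ℤ a)
⟂-prime-∤ {p} pp (bézout x y eq) p∣a = Prime.¬prime[1] (subst Prime (∣.∣1⇒≡1 (∣⇒∣ᵤ p∣1)) pp)
  where
  p∣1 : + p ∣ℤ 1ℤ
  p∣1 = subst (+ p ∣ℤ_) eq (∣ℤ.∣m∣n⇒∣m+n (∣ℤ.∣n⇒∣m*n x ∣ℤ.∣-refl) (∣ℤ.∣n⇒∣m*n y p∣a))

prime-∣-* : ∀ {p} → Prime p → ∀ a b → + p ∣ℤ a * b → + p ∣ℤ a ⊎ + p ∣ℤ b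
prime-∣-* {p} pp a b p∣ab
  with Prime.euclidsLemma ℤ.∣ a ∣ ℤ.∣ b ∣ pp (subst (p ∣_) (ℤ.abs-* a b) (∣⇒∣ᵤ p∣ab))
... | inj₁ q = inj₁ (∣ᵤ⇒∣ q)
... | inj₂ q = inj₂ (∣ᵤ⇒∣ q)

-- The Gauss–Schering sign

sgn : Bool → ℤ
sgn false = 1ℤ
sgn true  = -1ℤ

sgn-xor : ∀ b b′ → sgn (b xor b′) ≡ sgn b * sgn b′
sgn-xor false false = refl
sgn-xor false true  = refl
sgn-xor true  false = refl
sgn-xor true  true  = refl

odd : ℕ → ℕ
odd h = suc (2 ℕ.* h)

+odd : ∀ h → + odd h ≡ 1ℤ + + 2 * + h
+odd h = cong (λ t → 1ℤ + t) (ℤ.pos-* 2 h)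

-- The numbers 1, ..., h form a half-system modulo 2h + 1: each nonzero residue is plus or minus
-- exactly one of them.
half : ∀ {h} → Fin h → ℤ
half i = + suc (toℕ i)

flips : ∀ h → ℤ → Fin h → Bool
flips h a i = does (h ℕ.<? (a * half i) ℤ.%ℕ odd h)

-- The Legendre symbol for a prime modulus 2h + 1 (Gauss's lemma), the Jacobi
-- symbol in general.
ε : ℕ → ℤ → ℤ
ε h a = prodℤ λ i → sgn (flips h a i)

module _ {h : ℕ} where

  private
    u = odd h

  half<u : (i : Fin h) → suc (toℕ i) < u
  half<u i = s≤s (ℕ.≤-trans (Fin.toℕ<n i) (ℕ.m≤m+n h _))

  half-sum<u : (i j : Fin h) → suc (toℕ i) ℕ.+ suc (toℕ j) < u
  half-sum<u i j = s≤s (ℕ.≤-trans (ℕ.+-mono-≤ (Fin.toℕ<n i) (Fin.toℕ<n j))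
                                  (ℕ.≤-reflexive (cong (h ℕ.+_) (sym (ℕ.+-identityʳ h)))))

  half-positive : (i j : Fin h) → ¬ (half i + half j ≋ 0ℤ [ + u ])
  half-positive i j p with ∣-small⇒≡0 (≋0⇒∣ p) (half-sum<u i j)
  ... | ()

  -- Two elements of the half-system are never opposite, because their sum lies strictly between 0
  -- and u; equal signs reduce to comparing residues below u.
  signed-unique : ∀ b b′ (i j : Fin h) → sgn b * half i ≋ sgn b′ * half j [ + u ] → b ≡ b′ × i ≡ j
  signed-unique false false i j p = refl , Fin.toℕ-injective (ℕ.suc-injective
    (≋-small⇒≡ (half<u i) (half<u j)
      (≋-trans (≋-reflexive (sym (ℤ.*-identityˡ (half i)))) (≋-trans p (≋-reflexive (ℤ.*-identityˡ (half j)))))))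
  signed-unique true true i j p = refl , proj₂ (signed-unique false false i j
    (≋-trans (≋-reflexive (lemma (half i))) (≋-trans (*-modˡ -1ℤ p) (≋-reflexive (sym (lemma (half j)))))))
    where
    lemma : ∀ x → 1ℤ * x ≡ -1ℤ * (-1ℤ * x)
    lemma = solve-∀
  signed-unique false true i j p = ⊥-elim (half-positive i j
    (≋-trans (+-mod (≋-trans (≋-reflexive (sym (ℤ.*-identityˡ (half i)))) p) (≋-refl {a = half j}))
             (≋-reflexive (lemma (half j)))))
    where
    lemma : ∀ x → -1ℤ * x + x ≡ 0ℤ
    lemma = solve-∀
  signed-unique true false i j p = ⊥-elim (half-positive j i
    (≋-trans (+-mod (≋-trans (≋-reflexive (sym (ℤ.*-identityˡ (half j)))) (≋-sym p)) (≋-refl {a = half i}))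
             (≋-reflexive (lemma (half i)))))
    where
    lemma : ∀ x → -1ℤ * x + x ≡ 0ℤ
    lemma = solve-∀

  represent : ∀ r → suc r < u → ∃ λ (j : Fin h) → + suc r ≋ sgn (does (h ℕ.<? suc r)) * half j [ + u ]
  represent r r<u = by-cases (h ℕ.<? suc r)
    where
    Goal : Bool → Set
    Goal b = ∃ λ (j : Fin h) → + suc r ≋ sgn b * half j [ + u ]
    small : r < h → Goal false
    small r<h = fromℕ< r<h ,
      ≋-reflexive (trans (cong (λ t → + suc t) (sym (Fin.toℕ-fromℕ< r<h))) (sym (ℤ.*-identityˡ (half (fromℕ< r<h)))))
    large : h < suc r → Goal true
    large h<r = fromℕ< k<h , mod (divides 1ℤ equation)
      where
      -- The negative of `suc r` is u - (r + 1), and `half` starts at 1, so its index is one less.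
      k : ℕ
      k = u ∸ suc (suc r)
      r+k≡u : suc r ℕ.+ suc k ≡ u
      r+k≡u = trans (ℕ.+-suc (suc r) k) (ℕ.m+[n∸m]≡n r<u)
      k<h : k < h
      k<h = ℕ.+-cancelˡ-≤ (suc h) (suc k) h (ℕ.≤-trans (ℕ.+-monoˡ-≤ (suc k) h<r)
              (ℕ.≤-reflexive (trans r+k≡u (cong (λ t → suc (h ℕ.+ t)) (ℕ.+-identityʳ h)))))
      lemma : ∀ a b → a - -1ℤ * b ≡ a + b
      lemma = solve-∀
      equation : + suc r - -1ℤ * half (fromℕ< k<h) ≡ 1ℤ * + u
      equation = begin
        + suc r - -1ℤ * half (fromℕ< k<h)  ≡⟨ lemma (+ suc r) (half (fromℕ< k<h)) ⟩
        + suc r + half (fromℕ< k<h)        ≡⟨ cong (λ t → + suc r + + suc t) (Fin.toℕ-fromℕ< k<h) ⟩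
        + suc r + + suc k                  ≡⟨ cong +_ r+k≡u ⟩
        + u                                ≡⟨ sym (ℤ.*-identityˡ (+ u)) ⟩
        1ℤ * + u                           ∎
        where open ≡-Reasoning
    by-cases : Dec (h < suc r) → Goal (does (h ℕ.<? suc r))
    by-cases (yes p) = subst Goal (sym (dec-true (h ℕ.<? suc r) p)) (large p)
    by-cases (no ¬p) = subst Goal (sym (dec-false (h ℕ.<? suc r) ¬p)) (small (ℕ.≮⇒≥ ¬p))

  reduce : ∀ {a} → + u ⟂ a → (i : Fin h) → ∃ λ (j : Fin h) → a * half i ≋ sgn (flips h a i) * half j [ + u ]
  reduce {a} u⟂a i = go ((a * half i) ℤ.%ℕ u) (ℤ.n%ℕd<d (a * half i) u) (%ℕ-mod (a * half i) u)
    where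
    r≢0 : ¬ (a * half i ≋ 0ℤ [ + u ])
    r≢0 p = ℕ.1+n≢0 (≋-small⇒≡ {u} {suc (toℕ i)} {0} (half<u i) (s≤s z≤n)
      (⟂-cancelˡ {+ u} {a} {half i} {0ℤ} u⟂a (≋-trans p (≋-reflexive (sym (ℤ.*-zeroʳ a))))))
    go : ∀ r → r < u → + r ≋ a * half i [ + u ] →
         ∃ λ (j : Fin h) → a * half i ≋ sgn (does (h ℕ.<? r)) * half j [ + u ]
    go zero    r<u p = ⊥-elim (r≢0 (≋-sym p))
    go (suc r) r<u p = proj₁ (represent r r<u) , ≋-trans (≋-sym p) (proj₂ (represent r r<u))

  π : ∀ {a} → + u ⟂ a → Fin h → Fin h
  π u⟂a i = proj₁ (reduce u⟂a i)

  -- The way to compute `flips` and `π`: any signed representation of `a * half i` that can be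
  -- exhibited must be the one they record.
  reduce-unique : ∀ {a} (u⟂a : + u ⟂ a) i b j → a * half i ≋ sgn b * half j [ + u ] →
                  flips h a i ≡ b × π u⟂a i ≡ j
  reduce-unique u⟂a i b j p =
    signed-unique _ b _ j (≋-trans (≋-sym (proj₂ (reduce u⟂a i))) p)

  flips-mod : ∀ {a b} → + u ⟂ a → a ≋ b [ + u ] → ∀ i → flips h a i ≡ flips h b i
  flips-mod {a} {b} u⟂a p i = proj₁ (reduce-unique u⟂a i _ _
    (≋-trans (*-modʳ (half i) p) (proj₂ (reduce (⟂-mod p u⟂a) i))))

  ε-mod : ∀ {a b} → + u ⟂ a → a ≋ b [ + u ] → ε h a ≡ ε h b
  ε-mod u⟂a p = Π.sum-cong-≗ (λ i → cong sgn (flips-mod u⟂a p i))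

  reduce-∘ : ∀ {a b} (u⟂a : + u ⟂ a) (u⟂b : + u ⟂ b) i →
    (a * b) * half i ≋ sgn (flips h b i xor flips h a (π u⟂b i)) * half (π u⟂a (π u⟂b i)) [ + u ]
  reduce-∘ {a} {b} u⟂a u⟂b i =
    ≋-trans (≋-reflexive (ℤ.*-assoc a b (half i)))
      (≋-trans (*-modˡ a (proj₂ (reduce u⟂b i)))
        (≋-trans (≋-reflexive (swap a (sgn s) (half (π u⟂b i))))
          (≋-trans (*-modˡ (sgn s) (proj₂ (reduce u⟂a (π u⟂b i))))
            (≋-reflexive (trans (sym (ℤ.*-assoc (sgn s) (sgn t) _)) (cong (_* half (π u⟂a (π u⟂b i))) (sym (sgn-xor s t))))))))
    where
    s t : Bool
    s = flips h b i
    t = flips h a (π u⟂b i)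
    swap : ∀ a b c → a * (b * c) ≡ b * (a * c)
    swap = solve-∀

  π-inverse : ∀ {a b} (u⟂a : + u ⟂ a) (u⟂b : + u ⟂ b) → a * b ≋ 1ℤ [ + u ] → ∀ i → π u⟂a (π u⟂b i) ≡ i
  π-inverse {a} {b} u⟂a u⟂b p i =
    proj₂ (signed-unique (flips h b i xor flips h a (π u⟂b i)) false _ i
      (≋-trans (≋-sym (reduce-∘ u⟂a u⟂b i)) (*-modʳ (half i) p)))

  π-permutation : ∀ {a} → + u ⟂ a → Permutation h h
  π-permutation {a} u⟂a with ⟂-inverse u⟂a
  ... | b , ba≋1 = permutation (π u⟂a) (π u⟂b) (π-inverse u⟂a u⟂b ab≋1) (π-inverse u⟂b u⟂a ba≋1)
    where
    ab≋1 : a * b ≋ 1ℤ [ + u ]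
    ab≋1 = ≋-trans (≋-reflexive (ℤ.*-comm a b)) ba≋1
    u⟂b : + u ⟂ b
    u⟂b = inverse-⟂ b a ab≋1

  prod-π : ∀ {a} (u⟂a : + u ⟂ a) (f : Fin h → ℤ) → prodℤ (λ i → f (π u⟂a i)) ≡ prodℤ f
  prod-π u⟂a f = sym (Π.sum-permute f (π-permutation u⟂a))

  -- Multiplying by b and then by a adds up the flips, and the flips of a are met at `π` of b, which
  -- only permutes the factors of the product. This holds for every odd modulus, prime or composite.
  ε-* : ∀ {a b} → + u ⟂ a → + u ⟂ b → ε h (a * b) ≡ ε h a * ε h b
  ε-* {a} {b} u⟂a u⟂b = begin
    prodℤ (λ i → sgn (flips h (a * b) i))
      ≡⟨ Π.sum-cong-≗ (λ i → trans (cong sgn (proj₁ (reduce-unique (⟂-* u⟂a u⟂b) i _ _ (reduce-∘ u⟂a u⟂b i))))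
                                   (sgn-xor (flips h b i) _)) ⟩
    prodℤ (λ i → sgn (flips h b i) * sgn (flips h a (π u⟂b i)))
      ≡⟨ Π.∑-distrib-+ (λ i → sgn (flips h b i)) _ ⟩
    ε h b * prodℤ (λ i → sgn (flips h a (π u⟂b i)))
      ≡⟨ cong (ε h b *_) (prod-π u⟂b (λ i → sgn (flips h a i))) ⟩
    ε h b * ε h a
      ≡⟨ ℤ.*-comm (ε h b) (ε h a) ⟩
    ε h a * ε h b ∎
    where open ≡-Reasoning

  ε-sign : ∀ a → ε h a ≡ 1ℤ ⊎ ε h a ≡ -1ℤ
  ε-sign a = prod-sign (flips h a)
    where
    prod-sign : ∀ {n} (f : Fin n → Bool) → prodℤ (sgn ∘ f) ≡ 1ℤ ⊎ prodℤ (sgn ∘ f) ≡ -1ℤ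
    prod-sign {zero}  f = inj₁ refl
    prod-sign {suc n} f with f zero | prod-sign (f ∘ suc)
    ... | false | inj₁ p = inj₁ (cong (1ℤ *_) p)
    ... | false | inj₂ p = inj₂ (cong (1ℤ *_) p)
    ... | true  | inj₁ p = inj₂ (cong (-1ℤ *_) p)
    ... | true  | inj₂ p = inj₁ (cong (-1ℤ *_) p)

  ε-square : ∀ {a} → + u ⟂ a → ε h (a * a) ≡ 1ℤ
  ε-square {a} u⟂a with ε-sign a
  ... | inj₁ p = trans (ε-* u⟂a u⟂a) (cong₂ _*_ p p)
  ... | inj₂ p = trans (ε-* u⟂a u⟂a) (cong₂ _*_ p p)

  ε-1 : ε h 1ℤ ≡ 1ℤ
  ε-1 = ε-square (⟂-1 (+ u))

  -- Multiply the congruences of `reduce` over the half-system; `π` permutes it, so the same product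
  -- of elements of the half-system stands on both sides.
  gauss : ∀ {a} → + u ⟂ a → a ^ h * prodℤ {h} half ≋ ε h a * prodℤ {h} half [ + u ]
  gauss {a} u⟂a =
    ≋-trans (≋-reflexive (sym (prod-scale h half)))
      (≋-trans (prod-mod (λ i → proj₂ (reduce u⟂a i)))
        (≋-reflexive (trans (Π.∑-distrib-+ (λ i → sgn (flips h a i)) _) (cong (ε h a *_) (prod-π u⟂a half)))))
    where
    prod-scale : ∀ n (f : Fin n → ℤ) → prodℤ (λ i → a * f i) ≡ a ^ n * prodℤ f
    prod-scale zero    f = refl
    prod-scale (suc n) f = trans (cong (a * f zero *_) (prod-scale n (f ∘ suc))) (lemma a (f zero) (a ^ n) _)
      where
      lemma : ∀ a b c d → a * b * (c * d) ≡ a * c * (b * d)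
      lemma = solve-∀

prod-const : ∀ {n} (f : Fin n → ℤ) z → (∀ i → f i ≡ z) → prodℤ f ≡ z ^ n
prod-const {zero}  f z p = refl
prod-const {suc n} f z p = cong₂ _*_ (p zero) (prod-const (f ∘ suc) z (p ∘ suc))

-1^even : ∀ k → -1ℤ ^ (2 ℕ.* k) ≡ 1ℤ
-1^even k = trans (sym (ℤ.^-*-assoc -1ℤ 2 k)) (ℤ.^-zeroˡ k)

ε-neg1 : ∀ h → ε h -1ℤ ≡ -1ℤ ^ h
ε-neg1 h = prod-const {h} _ -1ℤ (λ i → cong sgn (proj₁ (reduce-unique (⟂-neg (⟂-1 (+ odd h))) i true i ≋-refl)))

-- Periodicity of the sign in the modulus

χ : {P : Set} → Dec P → ℤ
χ P? = sgn (does P?)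

χ-true : ∀ {P : Set} (P? : Dec P) → P → χ P? ≡ -1ℤ
χ-true P? p = cong sgn (dec-true P? p)

χ-false : ∀ {P : Set} (P? : Dec P) → ¬ P → χ P? ≡ 1ℤ
χ-false P? ¬p = cong sgn (dec-false P? ¬p)

χ-⇔ : ∀ {P Q : Set} (P? : Dec P) (Q? : Dec Q) → (P → Q) → (Q → P) → χ P? ≡ χ Q?
χ-⇔ P? Q? f g = cong sgn (does-⇔ (mk⇔ f g) P? Q?)

prodTo : ℕ → (ℕ → ℤ) → ℤ
prodTo n f = prodℤ {n} λ i → f (toℕ i)

prodTo-cong : ∀ n {f g : ℕ → ℤ} → (∀ i → i < n → f i ≡ g i) → prodTo n f ≡ prodTo n g
prodTo-cong n p = Π.sum-cong-≗ {n} λ i → p (toℕ i) (Fin.toℕ<n i)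

prodTo-const : ∀ n {f : ℕ → ℤ} z → (∀ i → i < n → f i ≡ z) → prodTo n f ≡ z ^ n
prodTo-const n z p = prod-const {n} _ z λ i → p (toℕ i) (Fin.toℕ<n i)

prodTo-1 : ∀ n {f : ℕ → ℤ} → (∀ i → i < n → f i ≡ 1ℤ) → prodTo n f ≡ 1ℤ
prodTo-1 n p = trans (prodTo-const n 1ℤ p) (ℤ.^-zeroˡ n)

prodTo-split : ∀ m n f → prodTo (m ℕ.+ n) f ≡ prodTo m f * prodTo n (λ i → f (m ℕ.+ i))
prodTo-split zero    n f = sym (ℤ.*-identityˡ (prodTo n f))
prodTo-split (suc m) n f = trans (cong (f 0 *_) (prodTo-split m n (f ∘ suc)))
  (sym (ℤ.*-assoc (f 0) (prodTo m (f ∘ suc)) (prodTo n (λ i → f (suc m ℕ.+ i)))))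

prodTo-swap : ∀ m n (f : ℕ → ℕ → ℤ) → prodTo m (λ i → prodTo n (f i)) ≡ prodTo n (λ j → prodTo m (λ i → f i j))
prodTo-swap m n f = Π.∑-comm {m} {n} λ i j → f (toℕ i) (toℕ j)

-- T is the number of positive multiples of u up to B. Each contributes -1, so the product records
-- the parity of T.
threshold : ∀ A T u B → T ℕ.* u ≤ B → B < suc T ℕ.* u → T ≤ A →
            prodTo A (λ y → χ (suc y ℕ.* u ℕ.≤? B)) ≡ -1ℤ ^ T
threshold A T u B lo hi T≤A = begin
  prodTo A f
    ≡⟨ cong (λ t → prodTo t f) (sym (ℕ.m+[n∸m]≡n T≤A)) ⟩
  prodTo (T ℕ.+ (A ∸ T)) f
    ≡⟨ prodTo-split T (A ∸ T) f ⟩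
  prodTo T f * prodTo (A ∸ T) (λ y → f (T ℕ.+ y))
    ≡⟨ cong₂ _*_
         (prodTo-const T -1ℤ λ y y<T → χ-true (suc y ℕ.* u ℕ.≤? B) (ℕ.≤-trans (ℕ.*-monoˡ-≤ u y<T) lo))
         (prodTo-1 (A ∸ T) λ y _ → χ-false (suc (T ℕ.+ y) ℕ.* u ℕ.≤? B)
           λ p → ℕ.<⇒≱ hi (ℕ.≤-trans (ℕ.*-monoˡ-≤ u (s≤s (ℕ.m≤m+n T y))) p)) ⟩
  -1ℤ ^ T * 1ℤ
    ≡⟨ ℤ.*-identityʳ _ ⟩
  -1ℤ ^ T ∎
  where
  open ≡-Reasoning
  f : ℕ → ℤ
  f y = χ (suc y ℕ.* u ℕ.≤? B)

2r<odd : ∀ {h r} → r ≤ h → 2 ℕ.* r < odd h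
2r<odd r≤h = s≤s (ℕ.*-monoʳ-≤ 2 r≤h)

odd≤2r : ∀ {h r} → h < r → odd h ≤ 2 ℕ.* r
odd≤2r {h} {r} h<r = ℕ.≤-trans (ℕ.n≤1+n (odd h)) (ℕ.≤-trans (ℕ.≤-reflexive (lemma h)) (ℕ.*-monoʳ-≤ 2 h<r))
  where
  lemma : ∀ h → suc (suc (2 ℕ.* h)) ≡ 2 ℕ.* suc h
  lemma = ℕSolver.solve-∀

-- Write z for the product a (x + 1), where a = A + 1. Its residue exceeds h exactly when the
-- integer part of 2z / u is odd, and this integer part counts the multiples of u up to 2z. Since 2z
-- < a u, it suffices to test the first A multiples.
flips-count : ∀ h A x → suc x ≤ h →
  χ (h ℕ.<? (suc A ℕ.* suc x) ℕ.% odd h) ≡ prodTo A (λ y → χ (suc y ℕ.* odd h ℕ.≤? 2 ℕ.* (suc A ℕ.* suc x)))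
flips-count h A x x<h = by-cases (h ℕ.<? ρ)
  where
  u z ρ L : ℕ
  u = odd h
  z = suc A ℕ.* suc x
  ρ = z ℕ.% u
  L = z / u
  expand : 2 ℕ.* z ≡ 2 ℕ.* ρ ℕ.+ 2 ℕ.* L ℕ.* u
  expand = trans (cong (2 ℕ.*_) (ℕ.m≡m%n+[m/n]*n z u))
             (trans (ℕ.*-distribˡ-+ 2 ρ (L ℕ.* u)) (cong (2 ℕ.* ρ ℕ.+_) (sym (ℕ.*-assoc 2 L u))))
  2z<au : 2 ℕ.* z < suc A ℕ.* u
  2z<au = ℕ.≤-<-trans (ℕ.≤-reflexive (lemma (suc A) (suc x))) (ℕ.*-monoʳ-< (suc A) (2r<odd x<h))
    where
    lemma : ∀ a x → 2 ℕ.* (a ℕ.* x) ≡ a ℕ.* (2 ℕ.* x)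
    lemma = ℕSolver.solve-∀
  T≤A : ∀ T → T ℕ.* u ≤ 2 ℕ.* z → T ≤ A
  T≤A T p = ℕ.s≤s⁻¹ (ℕ.*-cancelʳ-< u T (suc A) (ℕ.≤-<-trans p 2z<au))
  by-cases : Dec (h < ρ) → χ (h ℕ.<? ρ) ≡ prodTo A (λ y → χ (suc y ℕ.* u ℕ.≤? 2 ℕ.* z))
  by-cases (yes h<r) = trans (χ-true (h ℕ.<? ρ) h<r) (sym
      (trans (threshold A (suc (2 ℕ.* L)) u (2 ℕ.* z) lo hi (T≤A (suc (2 ℕ.* L)) lo)) (cong (-1ℤ *_) (-1^even L))))
    where
    lo : suc (2 ℕ.* L) ℕ.* u ≤ 2 ℕ.* z
    lo = ℕ.≤-trans (ℕ.+-monoˡ-≤ (2 ℕ.* L ℕ.* u) (odd≤2r h<r)) (ℕ.≤-reflexive (sym expand))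
    hi : 2 ℕ.* z < suc (suc (2 ℕ.* L)) ℕ.* u
    hi = ℕ.≤-<-trans (ℕ.≤-reflexive expand) (ℕ.<-≤-trans (ℕ.+-monoˡ-< (2 ℕ.* L ℕ.* u) (ℕ.*-monoʳ-< 2 (ℕ.m%n<n z u)))
           (ℕ.≤-reflexive (lemma (2 ℕ.* L) u)))
      where
      lemma : ∀ l u → 2 ℕ.* u ℕ.+ l ℕ.* u ≡ suc (suc l) ℕ.* u
      lemma = ℕSolver.solve-∀
  by-cases (no h≮r) = trans (χ-false (h ℕ.<? ρ) h≮r) (sym
      (trans (threshold A (2 ℕ.* L) u (2 ℕ.* z) lo hi (T≤A (2 ℕ.* L) lo)) (-1^even L)))
    where
    lo : 2 ℕ.* L ℕ.* u ≤ 2 ℕ.* z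
    lo = ℕ.≤-trans (ℕ.m≤n+m (2 ℕ.* L ℕ.* u) (2 ℕ.* ρ)) (ℕ.≤-reflexive (sym expand))
    hi : 2 ℕ.* z < suc (2 ℕ.* L) ℕ.* u
    hi = ℕ.≤-<-trans (ℕ.≤-reflexive expand) (ℕ.+-monoˡ-< (2 ℕ.* L ℕ.* u) (2r<odd (ℕ.≮⇒≥ h≮r)))

-- A lattice point count in the manner of Eisenstein, with the products exchanged so that the outer
-- index y does not depend on the modulus. Each row can then be compared for two moduli.
ε-count : ∀ h A → ε h (+ suc A) ≡
  prodTo A (λ y → prodTo h (λ x → χ (suc y ℕ.* odd h ℕ.≤? 2 ℕ.* (suc A ℕ.* suc x))))
ε-count h A = trans
  (prodTo-cong h λ x x<h → trans (cong (λ t → χ (h ℕ.<? t ℤ.%ℕ odd h)) (sym (ℤ.pos-* (suc A) (suc x))))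
                                 (flips-count h A x x<h))
  (prodTo-swap h A (λ x y → χ (suc y ℕ.* odd h ℕ.≤? 2 ℕ.* (suc A ℕ.* suc x))))

-- Passing from u = 2h + 1 to u + 4a inserts 2y values of x before, and
-- 2(a − y) values after, those counted for u: both numbers are even.
ε-shift : ∀ h A → ε (h ℕ.+ 2 ℕ.* suc A) (+ suc A) ≡ ε h (+ suc A)
ε-shift h A = trans (ε-count h′ A) (trans (prodTo-cong A row) (sym (ε-count h A)))
  where
  a h′ : ℕ
  a = suc A
  h′ = h ℕ.+ 2 ℕ.* a
  row : ∀ y → y < A → prodTo h′ (λ x → χ (suc y ℕ.* odd h′ ℕ.≤? 2 ℕ.* (a ℕ.* suc x))) ≡
                      prodTo h (λ x → χ (suc y ℕ.* odd h ℕ.≤? 2 ℕ.* (a ℕ.* suc x)))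
  row y y<A = let open ≡-Reasoning in begin
    prodTo h′ f
      ≡⟨ cong (λ t → prodTo t f) reindex ⟩
    prodTo (2 ℕ.* Y ℕ.+ (h ℕ.+ 2 ℕ.* w)) f
      ≡⟨ prodTo-split (2 ℕ.* Y) (h ℕ.+ 2 ℕ.* w) f ⟩
    prodTo (2 ℕ.* Y) f * prodTo (h ℕ.+ 2 ℕ.* w) (λ x → f (2 ℕ.* Y ℕ.+ x))
      ≡⟨ cong₂ _*_ (prodTo-1 (2 ℕ.* Y) before) (prodTo-cong (h ℕ.+ 2 ℕ.* w) λ x _ → shifted x) ⟩
    1ℤ * prodTo (h ℕ.+ 2 ℕ.* w) g
      ≡⟨ ℤ.*-identityˡ _ ⟩
    prodTo (h ℕ.+ 2 ℕ.* w) g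
      ≡⟨ prodTo-split h (2 ℕ.* w) g ⟩
    prodTo h g * prodTo (2 ℕ.* w) (λ x → g (h ℕ.+ x))
      ≡⟨ cong (λ t → prodTo h g * t) (trans (prodTo-const (2 ℕ.* w) -1ℤ λ x _ → after x) (-1^even w)) ⟩
    prodTo h g * 1ℤ
      ≡⟨ ℤ.*-identityʳ _ ⟩
    prodTo h g ∎
    where
    Y w : ℕ
    Y = suc y
    w = a ∸ Y
    f g : ℕ → ℤ
    f x = χ (Y ℕ.* odd h′ ℕ.≤? 2 ℕ.* (a ℕ.* suc x))
    g x = χ (Y ℕ.* odd h ℕ.≤? 2 ℕ.* (a ℕ.* suc x))
    Y≤a : Y ≤ a
    Y≤a = ℕ.m≤n⇒m≤1+n y<A
    reindex : h′ ≡ 2 ℕ.* Y ℕ.+ (h ℕ.+ 2 ℕ.* w)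
    reindex = trans (cong (λ t → h ℕ.+ 2 ℕ.* t) (sym (ℕ.m+[n∸m]≡n Y≤a))) (lemma h Y w)
      where
      lemma : ∀ h y w → h ℕ.+ 2 ℕ.* (y ℕ.+ w) ≡ 2 ℕ.* y ℕ.+ (h ℕ.+ 2 ℕ.* w)
      lemma = ℕSolver.solve-∀
    lhs : Y ℕ.* odd h′ ≡ 4 ℕ.* (a ℕ.* Y) ℕ.+ Y ℕ.* odd h
    lhs = lemma Y h a
      where
      lemma : ∀ y h a → y ℕ.* suc (2 ℕ.* (h ℕ.+ 2 ℕ.* a)) ≡ 4 ℕ.* (a ℕ.* y) ℕ.+ y ℕ.* suc (2 ℕ.* h)
      lemma = ℕSolver.solve-∀
    rhs : ∀ x → 2 ℕ.* (a ℕ.* suc (2 ℕ.* Y ℕ.+ x)) ≡ 4 ℕ.* (a ℕ.* Y) ℕ.+ 2 ℕ.* (a ℕ.* suc x)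
    rhs = lemma a Y
      where
      lemma : ∀ a y x → 2 ℕ.* (a ℕ.* suc (2 ℕ.* y ℕ.+ x)) ≡ 4 ℕ.* (a ℕ.* y) ℕ.+ 2 ℕ.* (a ℕ.* suc x)
      lemma = ℕSolver.solve-∀
    before : ∀ x → x < 2 ℕ.* Y → f x ≡ 1ℤ
    before x x<2Y = χ-false (Y ℕ.* odd h′ ℕ.≤? 2 ℕ.* (a ℕ.* suc x)) (ℕ.<⇒≱ (begin-strict
      2 ℕ.* (a ℕ.* suc x)              ≤⟨ ℕ.*-monoʳ-≤ 2 (ℕ.*-monoʳ-≤ a x<2Y) ⟩
      2 ℕ.* (a ℕ.* (2 ℕ.* Y))          ≡⟨ lemma a Y ⟩
      4 ℕ.* (a ℕ.* Y)                  <⟨ ℕ.m<m+n (4 ℕ.* (a ℕ.* Y)) (s≤s z≤n) ⟩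
      4 ℕ.* (a ℕ.* Y) ℕ.+ Y ℕ.* odd h  ≡⟨ lhs ⟨
      Y ℕ.* odd h′                     ∎))
      where
      open ℕ.≤-Reasoning
      lemma : ∀ a y → 2 ℕ.* (a ℕ.* (2 ℕ.* y)) ≡ 4 ℕ.* (a ℕ.* y)
      lemma = ℕSolver.solve-∀
    shifted : ∀ x → f (2 ℕ.* Y ℕ.+ x) ≡ g x
    shifted x = χ-⇔ (Y ℕ.* odd h′ ℕ.≤? 2 ℕ.* (a ℕ.* suc (2 ℕ.* Y ℕ.+ x))) (Y ℕ.* odd h ℕ.≤? 2 ℕ.* (a ℕ.* suc x))
      (λ p → ℕ.+-cancelˡ-≤ (4 ℕ.* (a ℕ.* Y)) _ _
               (ℕ.≤-trans (ℕ.≤-reflexive (sym lhs)) (ℕ.≤-trans p (ℕ.≤-reflexive (rhs x)))))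
      (λ p → ℕ.≤-trans (ℕ.≤-reflexive lhs)
               (ℕ.≤-trans (ℕ.+-monoʳ-≤ (4 ℕ.* (a ℕ.* Y)) p) (ℕ.≤-reflexive (sym (rhs x)))))
    after : ∀ x → g (h ℕ.+ x) ≡ -1ℤ
    after x = χ-true (Y ℕ.* odd h ℕ.≤? 2 ℕ.* (a ℕ.* suc (h ℕ.+ x)))
      (ℕ.≤-trans (ℕ.*-mono-≤ Y≤a (odd≤2r (s≤s (ℕ.m≤m+n h x)))) (ℕ.≤-reflexive (lemma a (suc (h ℕ.+ x)))))
      where
      lemma : ∀ a x → a ℕ.* (2 ℕ.* x) ≡ 2 ℕ.* (a ℕ.* x)
      lemma = ℕSolver.solve-∀

-- Stated in terms of h: a period of 2a in h is a period of 4a in the modulus 2h + 1.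
ε-periodic : ∀ A {h h′} → + h ≋ + h′ [ + (2 ℕ.* suc A) ] → ε h (+ suc A) ≡ ε h′ (+ suc A)
ε-periodic A {h} {h′} p = by-cases (ℕ.≤-total h h′)
  where
  P : ℕ
  P = 2 ℕ.* suc A
  ε-shifts : ∀ h k → ε (h ℕ.+ k ℕ.* P) (+ suc A) ≡ ε h (+ suc A)
  ε-shifts h zero    = cong (λ t → ε t (+ suc A)) (ℕ.+-identityʳ h)
  ε-shifts h (suc k) = trans (cong (λ t → ε t (+ suc A)) (sym (ℕ.+-assoc h P (k ℕ.* P))))
                             (trans (ε-shifts (h ℕ.+ P) k) (ε-shift h A))
  later : ∀ {h h′} → + h ≋ + h′ [ + P ] → h ≤ h′ → ε h′ (+ suc A) ≡ ε h (+ suc A)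
  later {h} {h′} (mod d) h≤h′ with ∣⇒∣ᵤ d
  ... | ∣.divides k eq = trans (cong (λ t → ε t (+ suc A)) h′≡) (ε-shifts h k)
    where
    h′≡ : h′ ≡ h ℕ.+ k ℕ.* P
    h′≡ = trans (sym (ℕ.m+[n∸m]≡n h≤h′)) (cong (h ℕ.+_)
      (trans (sym (trans (cong ℤ.∣_∣ (ℤ.m-n≡m⊖n h h′)) (ℤ.∣⊖∣-≤ h≤h′))) eq))
  by-cases : h ≤ h′ ⊎ h′ ≤ h → ε h (+ suc A) ≡ ε h′ (+ suc A)
  by-cases (inj₁ h≤h′) = sym (later p h≤h′)
  by-cases (inj₂ h′≤h) = later (≋-sym p) h′≤h

-- Nonresidues and reciprocity

sumTo : ℕ → (ℕ → ℤ) → ℤ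
sumTo zero    f = 0ℤ
sumTo (suc n) f = sumTo n f + f n

sumTo-cong : ∀ {f g} n → (∀ i → f i ≡ g i) → sumTo n f ≡ sumTo n g
sumTo-cong zero    p = refl
sumTo-cong (suc n) p = cong₂ _+_ (sumTo-cong n p) (p n)

sumTo-linear : ∀ n f g k → sumTo n (λ v → f v + k * g v) ≡ sumTo n f + k * sumTo n g
sumTo-linear zero    f g k = lemma k
  where
  lemma : ∀ k → 0ℤ ≡ 0ℤ + k * 0ℤ
  lemma = solve-∀
sumTo-linear (suc n) f g k = trans (cong (_+ (f n + k * g n)) (sumTo-linear n f g k)) (lemma (sumTo n f) (sumTo n g) (f n) (g n) k)
  where
  lemma : ∀ a b c d k → a + k * b + (c + k * d) ≡ a + c + k * (b + d)
  lemma = solve-∀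

falling : ℤ → ℕ → ℤ
falling v zero    = 1ℤ
falling v (suc j) = falling v j * (v - + j)

falling-shift : ∀ v j → falling (1ℤ + v) (suc j) ≡ (1ℤ + v) * falling v j
falling-shift v zero    = lemma v
  where
  lemma : ∀ v → 1ℤ * (1ℤ + v - 0ℤ) ≡ (1ℤ + v) * 1ℤ
  lemma = solve-∀
falling-shift v (suc j) = begin
  falling (1ℤ + v) (suc j) * (1ℤ + v - (1ℤ + + j))  ≡⟨ cong (_* (1ℤ + v - (1ℤ + + j))) (falling-shift v j) ⟩
  (1ℤ + v) * falling v j * (1ℤ + v - (1ℤ + + j))    ≡⟨ lemma v (+ j) (falling v j) ⟩
  (1ℤ + v) * (falling v j * (v - + j))              ∎
  where
  open ≡-Reasoning
  lemma : ∀ v j f → (1ℤ + v) * f * (1ℤ + v - (1ℤ + j)) ≡ (1ℤ + v) * (f * (v - j))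
  lemma = solve-∀

falling-∣ : ∀ v j → v ∣ℤ falling v (suc j)
falling-∣ v zero    = divides 1ℤ (lemma v)
  where
  lemma : ∀ v → 1ℤ * (v - 0ℤ) ≡ 1ℤ * v
  lemma = solve-∀
falling-∣ v (suc j) = ∣ℤ.∣m⇒∣m*n (v - + suc j) (falling-∣ v j)

-- Discrete integration: (j + 1) times `falling v j` is the forward difference of
-- `falling v (suc j)`, so the sum telescopes.
sumTo-falling : ∀ n j → + suc j * sumTo n (λ v → falling (+ v) j) ≡ falling (+ n) (suc j)
sumTo-falling zero    j = trans (ℤ.*-zeroʳ (+ suc j)) (sym (∣ℤ.0∣⇒≡0 (falling-∣ 0ℤ j)))
sumTo-falling (suc n) j = begin
  + suc j * (sumTo n F + F n)                  ≡⟨ ℤ.*-distribˡ-+ (+ suc j) (sumTo n F) (F n) ⟩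
  + suc j * sumTo n F + + suc j * F n          ≡⟨ cong (_+ + suc j * F n) (sumTo-falling n j) ⟩
  F n * (+ n - + j) + (1ℤ + + j) * F n         ≡⟨ lemma (+ n) (+ j) (F n) ⟩
  (1ℤ + + n) * F n                             ≡⟨ sym (falling-shift (+ n) j) ⟩
  falling (+ suc n) (suc j)                    ∎
  where
  open ≡-Reasoning
  F : ℕ → ℤ
  F v = falling (+ v) j
  lemma : ∀ n j f → f * (n - j) + (1ℤ + j) * f ≡ (1ℤ + n) * f
  lemma = solve-∀

∤-small : ∀ {p k} → suc k < p → ¬ (+ p ∣ℤ + suc k)
∤-small k<p d = ℕ.<⇒≱ k<p (∣.∣⇒≤ (∣⇒∣ᵤ d))

-- One factor v of the power is traded at a time through v = (v - j) + j, which leads to sums of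
-- pure falling factorials. The bound on k + j keeps the factor j + 1 of `sumTo-falling` prime to q.
power-sum-∣ : ∀ {q} → Prime q → ∀ k j → suc (k ℕ.+ j) < q →
              + q ∣ℤ sumTo q (λ v → (+ v) ^ k * falling (+ v) j)
power-sum-∣ {q} qp zero j j<q
  with prime-∣-* qp (+ suc j) (sumTo q (λ v → falling (+ v) j))
         (subst (+ q ∣ℤ_) (sym (sumTo-falling q j)) (falling-∣ (+ q) j))
... | inj₁ d = contradiction d (∤-small j<q)
... | inj₂ d = subst (+ q ∣ℤ_) (sumTo-cong q (λ v → sym (ℤ.*-identityˡ (falling (+ v) j)))) d
power-sum-∣ {q} qp (suc k) j j<q = subst (+ q ∣ℤ_) (sym expand)
  (∣ℤ.∣m∣n⇒∣m+n (power-sum-∣ qp k (suc j) (subst (λ t → suc t < q) (sym (ℕ.+-suc k j)) j<q))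
                (∣ℤ.∣n⇒∣m*n (+ j) (power-sum-∣ qp k j (ℕ.<-trans (ℕ.n<1+n _) j<q))))
  where
  lemma : ∀ v w f j → v * w * f ≡ w * (f * (v - j)) + j * (w * f)
  lemma = solve-∀
  expand : sumTo q (λ v → (+ v) ^ suc k * falling (+ v) j) ≡
           sumTo q (λ v → (+ v) ^ k * falling (+ v) (suc j)) + + j * sumTo q (λ v → (+ v) ^ k * falling (+ v) j)
  expand = trans (sumTo-cong q (λ v → lemma (+ v) ((+ v) ^ k) (falling (+ v) j) (+ j)))
                 (sumTo-linear q (λ v → (+ v) ^ k * falling (+ v) (suc j)) (λ v → (+ v) ^ k * falling (+ v) j) (+ j))

prod-⟂ : ∀ {u n} (f : Fin n → ℤ) → (∀ i → u ⟂ f i) → u ⟂ prodℤ f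
prod-⟂ {u} {zero}  f p = ⟂-1 u
prod-⟂ {u} {suc n} f p = ⟂-* (p zero) (prod-⟂ (f ∘ suc) (p ∘ suc))

-- If all signs were 1, `gauss` would give v^h ≡ 1 for all v from 1 to q - 1, and the sum of v^h
-- over all residues would be q - 1. But that sum is divisible by q, since h < q - 1.
nonresidue : ∀ h → Prime (odd h) → ∃ λ v → suc v < odd h × ε h (+ suc v) ≡ -1ℤ
nonresidue zero qp = ⊥-elim (Prime.¬prime[1] qp)
nonresidue h@(suc h-1) qp = by-cases (Fin.any? λ i → ε h (+ suc (toℕ i)) ℤ.≟ -1ℤ)
  where
  q : ℕ
  q = odd h
  v<q : (i : Fin (2 ℕ.* h)) → suc (toℕ i) < q
  v<q i = s≤s (Fin.toℕ<n i)
  ⟂-small : ∀ {v} → suc v < q → + q ⟂ + suc v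
  ⟂-small v<q = prime-∤⇒⟂ qp (∤-small v<q)
  absurd : (∀ v → suc v < q → ε h (+ suc v) ≡ 1ℤ) → ⊥
  absurd all-1 = ℕ.1+n≢0 (≋-small⇒≡ {q} {2 ℕ.* h} {0} ℕ.≤-refl (s≤s z≤n)
      (≋-trans (≋-sym (count (2 ℕ.* h) ℕ.≤-refl)) (∣⇒≋0 total)))
    where
    f : ℕ → ℤ
    f v = (+ v) ^ h * falling (+ v) 0
    power : ∀ v → suc v < q → f (suc v) ≋ 1ℤ [ + q ]
    power v v<q = ≋-trans (≋-reflexive (ℤ.*-identityʳ ((+ suc v) ^ h)))
      (⟂-cancelˡ {+ q} {H} (prod-⟂ {+ q} {h} half (λ i → ⟂-small (half<u i)))
        (≋-trans (≋-reflexive (ℤ.*-comm H ((+ suc v) ^ h)))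
          (≋-trans (gauss {h} {+ suc v} (⟂-small v<q)) (≋-reflexive (trans (cong (_* H) (all-1 v v<q)) (ℤ.*-comm 1ℤ H))))))
      where
      H : ℤ
      H = prodℤ {h} half
    -- The term at v = 0 vanishes because h ≥ 1, so n + 1 terms add up to n.
    count : ∀ n → n < q → sumTo (suc n) f ≋ + n [ + q ]
    count zero    _   = ≋-refl
    count (suc n) n<q = ≋-trans (+-mod (count n (ℕ.<-trans (ℕ.n<1+n n) n<q)) (power n n<q))
                                (≋-reflexive (ℤ.+-comm (+ n) 1ℤ))
    total : + q ∣ℤ sumTo q f
    total = power-sum-∣ qp h 0 (s≤s (ℕ.+-monoˡ-≤ (h ℕ.+ 0) {1} {h} (s≤s z≤n)))
  by-cases : Dec (∃ λ (i : Fin (2 ℕ.* h)) → ε h (+ suc (toℕ i)) ≡ -1ℤ) → ∃ λ v → suc v < q × ε h (+ suc v) ≡ -1ℤ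
  by-cases (yes (i , e)) = toℕ i , v<q i , e
  by-cases (no none) = ⊥-elim (absurd λ v v<q → [ (λ p → p) , (λ p → ⊥-elim (none
      (fromℕ< (ℕ.s<s⁻¹ v<q) , trans (cong (λ t → ε h (+ suc t)) (Fin.toℕ-fromℕ< (ℕ.s<s⁻¹ v<q))) p))) ]′ (ε-sign {h} (+ suc v)))

≋-ℕ : ∀ {u a b} k → a ≡ b ℕ.+ k ℕ.* u → + a ≋ + b [ + u ]
≋-ℕ {u} {a} {b} k refl = ≋-trans (≋-reflexive (cong (λ t → + b + t) (ℤ.pos-* k u))) (≋-multiple (+ b) (+ k))

odd⟂2 : ∀ h → + odd h ⟂ + 2
odd⟂2 h = bézout 1ℤ (- + h) (trans (cong (λ t → 1ℤ * t + - + h * + 2) (+odd h)) (lemma (+ h)))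
  where
  lemma : ∀ h → 1ℤ * (1ℤ + + 2 * h) + - h * + 2 ≡ 1ℤ
  lemma = solve-∀

⟂-neg1 : ∀ u → u ⟂ -1ℤ
⟂-neg1 u = ⟂-neg (⟂-1 u)

±-cancel : ∀ {x y} → x * y ≡ 1ℤ → y ≡ -1ℤ → (x ≡ 1ℤ ⊎ x ≡ -1ℤ) → x ≡ -1ℤ
±-cancel p refl (inj₁ refl) = contradiction p λ ()
±-cancel p refl (inj₂ q)    = q

-- A modulus u = 4e + 1 with (q/u) = -1. Requiring u ≡ 1 modulo 4 makes -1 have sign 1, so the sign
-- of n does not interfere later.
Base : ℕ → Set
Base q = ∃ λ e → ε (2 ℕ.* e) (+ q) ≡ -1ℤ × + odd (2 ℕ.* e) ⟂ + q

base-2 : Base 2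
base-2 = 1 , refl , odd⟂2 2

-- Take u = 2q - 1. Then 2q ≡ 1 modulo u, so q and 2 have equal signs, and u ≡ 5 modulo 8 makes 2 a
-- nonresidue like it is modulo 5.
base-3mod4 : ∀ k → Base (3 ℕ.+ k ℕ.* 4)
base-3mod4 k = e , ±-cancel ε-product ε2≡-1 (ε-sign {h} (+ q)) , u⟂q
  where
  q e h u : ℕ
  q = 3 ℕ.+ k ℕ.* 4
  e = 1 ℕ.+ 2 ℕ.* k
  h = 2 ℕ.* e
  u = odd h
  2q≋1 : + q * + 2 ≋ 1ℤ [ + u ]
  2q≋1 = ≋-trans (≋-reflexive (sym (ℤ.pos-* q 2))) (≋-ℕ 1 (lemma k))
    where
    lemma : ∀ k → (3 ℕ.+ k ℕ.* 4) ℕ.* 2 ≡ 1 ℕ.+ 1 ℕ.* suc (2 ℕ.* (2 ℕ.* (1 ℕ.+ 2 ℕ.* k)))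
    lemma = ℕSolver.solve-∀
  u⟂q : + u ⟂ + q
  u⟂q = inverse-⟂ (+ q) (+ 2) (≋-trans (≋-reflexive (ℤ.*-comm (+ 2) (+ q))) 2q≋1)
  ε2≡-1 : ε h (+ 2) ≡ -1ℤ
  ε2≡-1 = ε-periodic 1 {h} {2} (≋-ℕ k (lemma k))
    where
    lemma : ∀ k → 2 ℕ.* (1 ℕ.+ 2 ℕ.* k) ≡ 2 ℕ.+ k ℕ.* 4
    lemma = ℕSolver.solve-∀
  ε-product : ε h (+ q) * ε h (+ 2) ≡ 1ℤ
  ε-product = trans (sym (ε-* {h} {+ q} {+ 2} u⟂q (odd⟂2 h)))
    (trans (ε-mod {h} {+ q * + 2} {1ℤ} (⟂-* u⟂q (odd⟂2 h)) 2q≋1) (ε-1 {h}))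

-- Quadratic reciprocity between q and u = q + 4a, read off from the period 4a of ε(a).
base-1mod4 : ∀ k → Prime (1 ℕ.+ k ℕ.* 4) → Base (1 ℕ.+ k ℕ.* 4)
base-1mod4 k qp = from-nonresidue (nonresidue (2 ℕ.* k) (subst Prime (lemma k) qp))
  where
  q : ℕ
  q = 1 ℕ.+ k ℕ.* 4
  lemma : ∀ k → 1 ℕ.+ k ℕ.* 4 ≡ suc (2 ℕ.* (2 ℕ.* k))
  lemma = ℕSolver.solve-∀
  from-nonresidue : (∃ λ v → suc v < odd (2 ℕ.* k) × ε (2 ℕ.* k) (+ suc v) ≡ -1ℤ) → Base q
  from-nonresidue (v , v<q , εv) = e , ε-q , u⟂q
    where
    -- Here a = (v + 1)(3k + 1), and 4 (3k + 1) = 3q + 1, so 4a is congruent modulo q to the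
    -- nonresidue v + 1. The choice of e gives u = q + 4a.
    A a e h u : ℕ
    A = 3 ℕ.* k ℕ.+ v ℕ.* suc (3 ℕ.* k)
    a = suc A
    e = k ℕ.+ a
    h = 2 ℕ.* e
    u = odd h
    4a≋v : + 2 * + 2 * + a ≋ + suc v [ + odd (2 ℕ.* k) ]
    4a≋v = ≋-trans (≋-reflexive (sym (ℤ.pos-* 4 a))) (≋-ℕ (3 ℕ.* suc v) (equation k v))
      where
      equation : ∀ k v → 4 ℕ.* (suc (3 ℕ.* k ℕ.+ v ℕ.* suc (3 ℕ.* k))) ≡ suc v ℕ.+ 3 ℕ.* suc v ℕ.* suc (2 ℕ.* (2 ℕ.* k))
      equation = ℕSolver.solve-∀
    q⟂v : + odd (2 ℕ.* k) ⟂ + suc v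
    q⟂v = prime-∤⇒⟂ (subst Prime (lemma k) qp) (∤-small v<q)
    q⟂4a : + odd (2 ℕ.* k) ⟂ + 2 * + 2 * + a
    q⟂4a = ⟂-mod (≋-sym 4a≋v) q⟂v
    q⟂a : + odd (2 ℕ.* k) ⟂ + a
    q⟂a = ⟂-*⁻ (+ 2 * + 2) q⟂4a
    q⟂u : + odd (2 ℕ.* k) ⟂ + u
    q⟂u = ⟂-mod (≋-sym (≋-ℕ (1 ℕ.+ 3 ℕ.* suc v) (equation k v))) q⟂v
      where
      equation : ∀ k v → suc (2 ℕ.* (2 ℕ.* (k ℕ.+ suc (3 ℕ.* k ℕ.+ v ℕ.* suc (3 ℕ.* k))))) ≡
                         suc v ℕ.+ (1 ℕ.+ 3 ℕ.* suc v) ℕ.* suc (2 ℕ.* (2 ℕ.* k))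
      equation = ℕSolver.solve-∀
    u⟂q : + u ⟂ + q
    u⟂q = subst (λ t → + u ⟂ + t) (sym (lemma k)) (⟂-sym q⟂u)
    q≋-4a : + q ≋ -1ℤ * (+ 2 * + 2 * + a) [ + u ]
    q≋-4a = mod (divides 1ℤ (trans (rearrange (+ q) (+ a))
              (trans (cong (λ t → + q + t) (sym (ℤ.pos-* 4 a)))
                (trans (cong +_ (equation k a)) (sym (ℤ.*-identityˡ (+ u)))))))
      where
      rearrange : ∀ q a → q - -1ℤ * (+ 2 * + 2 * a) ≡ q + + 4 * a
      rearrange = solve-∀
      equation : ∀ k a → 1 ℕ.+ k ℕ.* 4 ℕ.+ 4 ℕ.* a ≡ suc (2 ℕ.* (2 ℕ.* (k ℕ.+ a)))
      equation = ℕSolver.solve-∀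
    u⟂a : + u ⟂ + a
    u⟂a = ⟂-*⁻ (+ 2 * + 2) (⟂-*⁻ -1ℤ (⟂-mod q≋-4a u⟂q))
    ε-4a : ∀ h → + odd h ⟂ + a → ε h (+ 2 * + 2 * + a) ≡ ε h (+ a)
    ε-4a h h⟂a = trans (ε-* {h} {+ 2 * + 2} {+ a} (⟂-* (odd⟂2 h) (odd⟂2 h)) h⟂a)
      (trans (cong (_* ε h (+ a)) (ε-square {h} {+ 2} (odd⟂2 h))) (ℤ.*-identityˡ _))
    ε-q : ε h (+ q) ≡ -1ℤ
    ε-q = begin
      ε h (+ q)                                  ≡⟨ ε-mod {h} u⟂q q≋-4a ⟩
      ε h (-1ℤ * (+ 2 * + 2 * + a))              ≡⟨ ε-* {h} { -1ℤ} {+ 2 * + 2 * + a} (⟂-neg1 (+ u)) (⟂-* (⟂-* (odd⟂2 h) (odd⟂2 h)) u⟂a) ⟩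
      ε h -1ℤ * ε h (+ 2 * + 2 * + a)            ≡⟨ cong₂ _*_ (trans (ε-neg1 h) (-1^even e)) (ε-4a h u⟂a) ⟩
      1ℤ * ε h (+ a)                             ≡⟨ ℤ.*-identityˡ _ ⟩
      ε h (+ a)                                  ≡⟨ ε-periodic A {h} {2 ℕ.* k} (≋-ℕ 1 (equation k a)) ⟩
      ε (2 ℕ.* k) (+ a)                          ≡⟨ sym (ε-4a (2 ℕ.* k) q⟂a) ⟩
      ε (2 ℕ.* k) (+ 2 * + 2 * + a)              ≡⟨ ε-mod {2 ℕ.* k} q⟂4a 4a≋v ⟩
      ε (2 ℕ.* k) (+ suc v)                      ≡⟨ εv ⟩
      -1ℤ                                        ∎
      where
      open ≡-Reasoning
      equation : ∀ k a → 2 ℕ.* (k ℕ.+ a) ≡ 2 ℕ.* k ℕ.+ 1 ℕ.* (2 ℕ.* a)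
      equation = ℕSolver.solve-∀

prime⇒base : ∀ {q} → Prime q → Base q
prime⇒base {q} qp = by-residue (q ℕ.% 4) (ℕ.m%n<n q 4) (q / 4) (ℕ.m≡m%n+[m/n]*n q 4)
  where
  even-prime : 2 ∣ q → Base q
  even-prime 2∣q with Prime.prime⇒irreducible qp 2∣q
  ... | inj₂ refl = base-2
  by-residue : ∀ ρ → ρ < 4 → ∀ k → q ≡ ρ ℕ.+ k ℕ.* 4 → Base q
  by-residue 0 _ k eq = even-prime (∣.divides (k ℕ.* 2) (trans eq (sym (ℕ.*-assoc k 2 2))))
  by-residue 1 _ k refl = base-1mod4 k qp
  by-residue 2 _ k eq = even-prime (∣.divides (1 ℕ.+ k ℕ.* 2) (trans eq (cong (2 ℕ.+_) (sym (ℕ.*-assoc k 2 2)))))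
  by-residue 3 _ k refl = base-3mod4 k
  by-residue (suc (suc (suc (suc _)))) (s≤s (s≤s (s≤s (s≤s ()))))

-- Primes modulo which a nonsquare stays a nonsquare

prime-induction : (P : ℕ → Set) → P 1 → (∀ {p m} → Prime p → P m → P (p ℕ.* m)) → ∀ n → 1 ≤ n → P n
prime-induction P p1 step n@(suc _) 1≤n =
  subst P (sym (PrimeFactorisation.isFactorisation f)) (go (PrimeFactorisation.factorsPrime f))
  where
  f : PrimeFactorisation n
  f = factorise n
  go : ∀ {ps : List ℕ} → All Prime ps → P (product ps)
  go []         = p1
  go (pp ∷ pps) = step pp (go pps)

prime-divisor : ∀ n → 2 ≤ n → ∃ λ p → Prime p × p ∣ n
prime-divisor n 2≤n = [ (λ { refl → contradiction 2≤n (ℕ.<-irrefl refl) }) , (λ d → d) ]′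
  (prime-induction (λ n → n ≡ 1 ⊎ ∃ λ p → Prime p × p ∣ n) (inj₁ refl)
    (λ {p} {m} pp _ → inj₂ (p , pp , ∣.m∣m*n m)) n (ℕ.<⇒≤ 2≤n))

-- The prime q has odd exponent in N; all that matters later is that its sign occurs exactly once
-- after removing the square.
NonSquarePart : ℕ → Set
NonSquarePart N = ∃ λ w → ∃₂ λ q b → Prime q × ¬ (q ∣ b) × N ≡ w ℕ.* w ℕ.* (q ℕ.* b)

square-or-nonsquare : ∀ N → 1 ≤ N → (∃ λ m → N ≡ m ℕ.* m) ⊎ NonSquarePart N
square-or-nonsquare N = go N (<-wellFounded N)
  where
  go : ∀ N → Acc _<_ N → 1 ≤ N → (∃ λ m → N ≡ m ℕ.* m) ⊎ NonSquarePart N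
  go 1               _        _ = inj₁ (1 , refl)
  go N@(suc (suc _)) (acc rec) 1≤N with prime-divisor N (s≤s (s≤s z≤n))
  ... | q , qp , ∣.divides M N≡Mq with q ∣.∣? M
  ... | no q∤M = inj₂ (1 , q , M , qp , q∤M , trans N≡Mq (trans (ℕ.*-comm M q) (sym (ℕ.*-identityˡ (q ℕ.* M)))))
  ... | yes (∣.divides M′ refl) = extend (go M′ (rec M′<N) 1≤M′)
    where
    N≡ : N ≡ q ℕ.* q ℕ.* M′
    N≡ = trans N≡Mq (lemma M′ q)
      where
      lemma : ∀ m q → m ℕ.* q ℕ.* q ≡ q ℕ.* q ℕ.* m
      lemma = ℕSolver.solve-∀
    1≤M′ : 1 ≤ M′
    1≤M′ = ℕ.n≢0⇒n>0 λ { refl → contradiction (trans N≡ (ℕ.*-zeroʳ (q ℕ.* q))) λ () }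
    M′<N : M′ < N
    M′<N = subst (M′ <_) (sym N≡) (ℕ.<-≤-trans (ℕ.m<m*n M′ (q ℕ.* q) {{ℕ.>-nonZero 1≤M′}} 1<qq) (ℕ.≤-reflexive (ℕ.*-comm M′ (q ℕ.* q))))
      where
      1<q : 1 < q
      1<q = ℕ.nonTrivial⇒n>1 q {{Prime.prime⇒nonTrivial qp}}
      1<qq : 1 < q ℕ.* q
      1<qq = ℕ.<-≤-trans 1<q (ℕ.m≤m*n q q {{Prime.prime⇒nonZero qp}})
    extend : (∃ λ m → M′ ≡ m ℕ.* m) ⊎ NonSquarePart M′ → (∃ λ m → N ≡ m ℕ.* m) ⊎ NonSquarePart N
    extend (inj₁ (m , refl)) = inj₁ (q ℕ.* m , trans N≡ (lemma q m))
      where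
      lemma : ∀ q m → q ℕ.* q ℕ.* (m ℕ.* m) ≡ q ℕ.* m ℕ.* (q ℕ.* m)
      lemma = ℕSolver.solve-∀
    extend (inj₂ (w , p , b , pp , p∤b , refl)) = inj₂ (q ℕ.* w , p , b , pp , p∤b , trans N≡ (lemma q w (p ℕ.* b)))
      where
      lemma : ∀ q w r → q ℕ.* q ℕ.* (w ℕ.* w ℕ.* r) ≡ q ℕ.* w ℕ.* (q ℕ.* w) ℕ.* r
      lemma = ℕSolver.solve-∀

crt : ∀ {m n} → m ⟂ n → ∀ a b → ∃ λ x → x ≋ a [ m ] × x ≋ b [ n ]
crt {m} {n} (bézout x y p) a b = b * (x * m) + a * (y * n) ,
  mod (divides ((b - a) * x) (mod-m)) , mod (divides ((a - b) * y) mod-n)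
  where
  open ≡-Reasoning
  lemma₁ : ∀ a b x m y n → b * (x * m) + a * (y * n) - a * (x * m + y * n) ≡ (b - a) * x * m
  lemma₁ = solve-∀
  lemma₂ : ∀ a b x m y n → b * (x * m) + a * (y * n) - b * (x * m + y * n) ≡ (a - b) * y * n
  lemma₂ = solve-∀
  mod-m : b * (x * m) + a * (y * n) - a ≡ (b - a) * x * m
  mod-m = trans (cong (λ t → b * (x * m) + a * (y * n) - t) (sym (trans (cong (a *_) p) (ℤ.*-identityʳ a)))) (lemma₁ a b x m y n)
  mod-n : b * (x * m) + a * (y * n) - b ≡ (a - b) * y * n
  mod-n = trans (cong (λ t → b * (x * m) + a * (y * n) - t) (sym (trans (cong (b *_) p) (ℤ.*-identityʳ b)))) (lemma₂ a b x m y n)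

mod-%ℕ : ∀ {m a} x k .{{_ : ℕ.NonZero k}} → m ∣ℤ + k → x ≋ a [ m ] → + (x ℤ.%ℕ k) ≋ a [ m ]
mod-%ℕ x k m∣k p = ≋-trans (mod-∣ m∣k (%ℕ-mod x k)) p

+∣+ : ∀ {m n} → m ∣ n → + m ∣ℤ + n
+∣+ = ∣ᵤ⇒∣

coprime-in-progression : ∀ Q → 1 ≤ Q → ∀ {a} → + Q ⟂ a → ∀ P → 1 ≤ P →
  ∃ λ u → u < Q ℕ.* P × + u ≋ a [ + Q ] × + u ⟂ + P
coprime-in-progression Q 1≤Q {a} Q⟂a P = go P (<-wellFounded P)
  where
  Goal : ℕ → Set
  Goal P = ∃ λ u → u < Q ℕ.* P × + u ≋ a [ + Q ] × + u ⟂ + P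
  go : ∀ P → Acc _<_ P → 1 ≤ P → Goal P
  go P (acc rec) 1≤P = by-gcd (gcd P Q) (gcd[m,n]∣m P Q) (gcd[m,n]∣n P Q) refl
    where
    coprime-case : gcd P Q ≡ 1 → Goal P
    coprime-case g≡1 = x ℤ.%ℕ (Q ℕ.* P) , ℤ.n%ℕd<d x (Q ℕ.* P) , mod-%ℕ x (Q ℕ.* P) (+∣+ (∣.m∣m*n P)) x≋a
        , ⟂-sym (⟂-mod (≋-sym (mod-%ℕ x (Q ℕ.* P) (+∣+ (∣.n∣m*n Q)) x≋1)) (⟂-1 (+ P)))
      where
      instance
        QP≢0 : ℕ.NonZero (Q ℕ.* P)
        QP≢0 = ℕ.>-nonZero (ℕ.*-mono-≤ 1≤Q 1≤P)
      sol : ∃ λ x → x ≋ a [ + Q ] × x ≋ 1ℤ [ + P ]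
      sol = crt (⟂-sym (Coprime⇒⟂ (gcd≡1⇒coprime g≡1))) a 1ℤ
      x : ℤ
      x = proj₁ sol
      x≋a : x ≋ a [ + Q ]
      x≋a = proj₁ (proj₂ sol)
      x≋1 : x ≋ 1ℤ [ + P ]
      x≋1 = proj₂ (proj₂ sol)
    by-gcd : ∀ g → g ∣ P → g ∣ Q → gcd P Q ≡ g → Goal P
    by-gcd 0 0∣P _ _ = ⊥-elim (ℕ.1+n≰n (ℕ.≤-trans 1≤P (ℕ.≤-reflexive (∣.0∣⇒≡0 0∣P))))
    by-gcd 1 _ _ g≡1 = coprime-case g≡1
    by-gcd g@(suc (suc _)) (∣.divides P′ refl) g∣Q _ = extend (go P′ (rec (ℕ.m<m*n P′ g {{ℕ.>-nonZero 1≤P′}} (s≤s (s≤s z≤n)))) 1≤P′)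
      where
      1≤P′ : 1 ≤ P′
      1≤P′ = ℕ.n≢0⇒n>0 λ { refl → contradiction 1≤P λ () }
      extend : Goal P′ → Goal (P′ ℕ.* g)
      extend (u , u<QP′ , u≋a , u⟂P′) = u , ℕ.<-≤-trans u<QP′ (ℕ.*-monoʳ-≤ Q (ℕ.m≤m*n P′ g)) , u≋a ,
        subst (+ u ⟂_) (sym (ℤ.pos-* P′ g)) (⟂-* u⟂P′ (⟂-∣ (+∣+ g∣Q) (⟂-sym (⟂-mod (≋-sym u≋a) Q⟂a))))

-- For prime p this forces p to be odd and not to divide n; such p are the primes inert in the field
-- generated by the square root of n.
InertAt : ℤ → ℕ → Set
InertAt n p = ∀ t → ¬ (+ p ∣ℤ t * t - n)

square-mod? : ∀ n p .{{_ : ℕ.NonZero p}} → (∃ λ t → + p ∣ℤ t * t - n) ⊎ InertAt n p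
square-mod? n p = by-cases (Fin.any? λ (i : Fin p) → + p ∣ℤ? (+ toℕ i * + toℕ i - n))
  where
  by-cases : Dec (∃ λ (i : Fin p) → + p ∣ℤ + toℕ i * + toℕ i - n) → (∃ λ t → + p ∣ℤ t * t - n) ⊎ InertAt n p
  by-cases (yes (i , d)) = inj₁ (+ toℕ i , d)
  by-cases (no none) = inj₂ λ t d → none (fromℕ< (ℤ.n%ℕd<d t p) ,
    subst (λ z → + p ∣ℤ + z * + z - n) (sym (Fin.toℕ-fromℕ< (ℤ.n%ℕd<d t p)))
      (difference (≋-trans (*-mod (%ℕ-mod t p) (%ℕ-mod t p)) (mod d))))

-- Hensel lifting when p ∣ m, the Chinese remainder theorem otherwise.
square-lift : ∀ {n p m} → Prime p → + p ⟂ + 2 → + p ⟂ n → (∃ λ r → + p ∣ℤ r * r - n) →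
              (∃ λ t → + m ∣ℤ t * t - n) → ∃ λ t → + (p ℕ.* m) ∣ℤ t * t - n
square-lift {n} {p} {m} pp p⟂2 p⟂n (r , p∣r²-n) (t , m∣t²-n) with + p ∣ℤ? + m
... | no p∤m = z , subst (_∣ℤ z * z - n) (sym (ℤ.pos-* p m))
        (⟂-*-∣ p⟂m (root-∣ z≋r p∣r²-n) (root-∣ z≋t m∣t²-n))
  where
  p⟂m : + p ⟂ + m
  p⟂m = prime-∤⇒⟂ pp p∤m
  sol : ∃ λ z → z ≋ r [ + p ] × z ≋ t [ + m ]
  sol = crt p⟂m r t
  z : ℤ
  z = proj₁ sol
  z≋r : z ≋ r [ + p ]
  z≋r = proj₁ (proj₂ sol)
  z≋t : z ≋ t [ + m ]
  z≋t = proj₂ (proj₂ sol)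
  root-∣ : ∀ {k y} → z ≋ y [ k ] → k ∣ℤ y * y - n → k ∣ℤ z * z - n
  root-∣ p d = difference (≋-trans (*-mod p p) (mod d))
... | yes (divides c m≡cp) = t + k * + m , divides l (begin
    (t + k * + m) * (t + k * + m) - n                  ≡⟨ lemma₁ t k (+ m) n ⟩
    (t * t - n) + (+ 2 * t * k + k * k * + m) * + m    ≡⟨ cong (_+ (+ 2 * t * k + k * k * + m) * + m) (_∣ℤ_.equality m∣t²-n) ⟩
    e * + m + (+ 2 * t * k + k * k * + m) * + m        ≡⟨ lemma₂ e (+ m) t k (k * k * + m) ⟩
    (e + + 2 * t * k) * + m + k * k * + m * + m        ≡⟨ cong₂ (λ x y → x * + m + k * k * y * + m) p∣e+2tk m≡cp ⟩
    l₀ * + p * + m + k * k * (c * + p) * + m           ≡⟨ lemma₃ l₀ (+ p) (+ m) k c ⟩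
    l * (+ p * + m)                                    ≡⟨ cong (l *_) (sym (ℤ.pos-* p m)) ⟩
    l * + (p ℕ.* m)                                    ∎)
  where
  open ≡-Reasoning
  e : ℤ
  e = _∣ℤ_.quotient m∣t²-n
  p⟂t : + p ⟂ t
  p⟂t = ⟂-*⁻ t (⟂-mod (≋-sym (mod (∣ℤ.∣-trans (divides c m≡cp) m∣t²-n))) p⟂n)
  inv : ∃ λ b → b * (+ 2 * t) ≋ 1ℤ [ + p ]
  inv = ⟂-inverse (⟂-* p⟂2 p⟂t)
  -- A Newton step: with t² - n = e m, this k solves e + 2tk ≡ 0 modulo p. The remaining term k² m²
  -- is divisible by p m because p divides m.
  k : ℤ
  k = - e * proj₁ inv
  lemma₀ : ∀ e t b → e + + 2 * t * (- e * b) ≡ e + - e * (b * (+ 2 * t))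
  lemma₀ = solve-∀
  p∣ : + p ∣ℤ e + + 2 * t * k
  p∣ = ≋0⇒∣ (≋-trans (≋-reflexive (lemma₀ e t (proj₁ inv)))
         (≋-trans (+-mod (≋-refl {a = e}) (*-modˡ (- e) (proj₂ inv))) (≋-reflexive (lemma e))))
    where
    lemma : ∀ e → e + - e * 1ℤ ≡ 0ℤ
    lemma = solve-∀
  l₀ : ℤ
  l₀ = _∣ℤ_.quotient p∣
  p∣e+2tk : e + + 2 * t * k ≡ l₀ * + p
  p∣e+2tk = _∣ℤ_.equality p∣
  l : ℤ
  l = l₀ + k * k * c
  lemma₁ : ∀ t k m n → (t + k * m) * (t + k * m) - n ≡ (t * t - n) + (+ 2 * t * k + k * k * m) * m
  lemma₁ = solve-∀
  lemma₂ : ∀ e m t k z → e * m + (+ 2 * t * k + z) * m ≡ (e + + 2 * t * k) * m + z * m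
  lemma₂ = solve-∀
  lemma₃ : ∀ l p m k c → l * p * m + k * k * (c * p) * m ≡ (l + k * k * c) * (p * m)
  lemma₃ = solve-∀

-- If n is a square modulo every prime factor of u, the roots are lifted one prime factor at a time
-- to a root modulo u. A sign of -1 excludes this outcome.
inert-or-square : ∀ n u → 1 ≤ u → + u ⟂ + 2 → + u ⟂ n →
  (∃ λ p → Prime p × p ∣ u × InertAt n p) ⊎ (∃ λ t → + u ∣ℤ t * t - n)
inert-or-square n = prime-induction _ (λ _ _ → inj₂ (0ℤ , divides (0ℤ * 0ℤ - n) (sym (ℤ.*-identityʳ _)))) step
  where
  Goal : ℕ → Set
  Goal u = + u ⟂ + 2 → + u ⟂ n → (∃ λ p → Prime p × p ∣ u × InertAt n p) ⊎ (∃ λ t → + u ∣ℤ t * t - n)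
  step : ∀ {p m} → Prime p → Goal m → Goal (p ℕ.* m)
  step {p} {m} pp rec pm⟂2 pm⟂n = by-cases (rec (m⟂ pm⟂2) (m⟂ pm⟂n)) (square-mod? n p {{Prime.prime⇒nonZero pp}})
    where
    p⟂ : ∀ {a} → + (p ℕ.* m) ⟂ a → + p ⟂ a
    p⟂ c = ⟂-sym (⟂-∣ (+∣+ (∣.m∣m*n m)) (⟂-sym c))
    m⟂ : ∀ {a} → + (p ℕ.* m) ⟂ a → + m ⟂ a
    m⟂ c = ⟂-sym (⟂-∣ (+∣+ (∣.n∣m*n p)) (⟂-sym c))
    by-cases : (∃ λ p → Prime p × p ∣ m × InertAt n p) ⊎ (∃ λ t → + m ∣ℤ t * t - n) →
               (∃ λ t → + p ∣ℤ t * t - n) ⊎ InertAt n p →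
               (∃ λ p′ → Prime p′ × p′ ∣ p ℕ.* m × InertAt n p′) ⊎ (∃ λ t → + (p ℕ.* m) ∣ℤ t * t - n)
    by-cases _ (inj₂ inert) = inj₁ (p , pp , ∣.m∣m*n m , inert)
    by-cases (inj₁ (p′ , pp′ , d , inert)) (inj₁ _) = inj₁ (p′ , pp′ , ∣.∣n⇒∣m*n p d , inert)
    by-cases (inj₂ root) (inj₁ root′) = inj₂ (square-lift pp (p⟂ pm⟂2) (p⟂ pm⟂n) root′ root)

-- The class of h modulo Q is the class of u = 2h + 1 modulo 2Q. Coprimality of its representative
-- to 2Q lets the class supply values of u coprime to any prescribed number.
NegativeClass : ℤ → Set
NegativeClass n = ∃₂ λ Q a → 1 ≤ Q × + (2 ℕ.* Q) ⟂ + odd a ×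
  (∀ h → + h ≋ + a [ + Q ] → + odd h ⟂ n → ε h n ≡ -1ℤ)

odd-mod : ∀ {u a b} → + a ≋ + b [ u ] → + odd a ≋ + odd b [ u ]
odd-mod {u} {a} {b} p = ≋-trans (≋-reflexive (+odd a)) (≋-trans (+-mod (≋-refl {a = 1ℤ}) (*-modˡ (+ 2) p)) (≋-reflexive (sym (+odd b))))

even-from-mod : ∀ {h} → + h ≋ 0ℤ [ + 2 ] → -1ℤ ^ h ≡ 1ℤ
even-from-mod p with ∣⇒∣ᵤ (≋0⇒∣ p)
... | ∣.divides k refl = trans (cong (-1ℤ ^_) (ℕ.*-comm k 2)) (-1^even k)

-- The sign of -m² is that of -1, namely (-1)^h, so u ≡ 3 modulo 4 works.
class-minus-square : ∀ m → NegativeClass (-1ℤ * + (m ℕ.* m))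
class-minus-square m = 2 , 1 , s≤s z≤n , bézout 1ℤ -1ℤ refl , sign
  where
  sign : ∀ h → + h ≋ + 1 [ + 2 ] → + odd h ⟂ -1ℤ * + (m ℕ.* m) → ε h (-1ℤ * + (m ℕ.* m)) ≡ -1ℤ
  sign zero    p _ = contradiction (∣.∣⇒≤ (∣⇒∣ᵤ (difference p))) λ { (s≤s ()) }
  sign (suc h) p c = begin
    ε (suc h) (-1ℤ * + (m ℕ.* m))             ≡⟨ cong (λ t → ε (suc h) (-1ℤ * t)) (ℤ.pos-* m m) ⟩
    ε (suc h) (-1ℤ * (+ m * + m))             ≡⟨ ε-* {suc h} { -1ℤ} {+ m * + m} (⟂-neg1 _) (⟂-* u⟂m u⟂m) ⟩
    ε (suc h) -1ℤ * ε (suc h) (+ m * + m)     ≡⟨ cong₂ _*_ (ε-neg1 (suc h)) (ε-square {suc h} {+ m} u⟂m) ⟩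
    -1ℤ * -1ℤ ^ h * 1ℤ                        ≡⟨ cong (λ t → -1ℤ * t * 1ℤ) (even-from-mod h-even) ⟩
    -1ℤ                                       ∎
    where
    open ≡-Reasoning
    u⟂m : + odd (suc h) ⟂ + m
    u⟂m = ⟂-*⁻ (+ m) (subst (+ odd (suc h) ⟂_) (ℤ.pos-* m m) (⟂-*⁻ -1ℤ c))
    h-even : + h ≋ 0ℤ [ + 2 ]
    h-even = +-mod {+ 2} {+ suc h} {1ℤ} { -1ℤ} p ≋-refl

-- Take h = 2y with y ≡ e modulo q and y ≡ 0 modulo b, where e is the base of q. Periodicity gives q
-- the sign -1 and b the sign 1, evenness of h gives σ the sign 1, and w² has sign 1 as a square.
class-nonsquare : ∀ σ w q b → σ ≡ 1ℤ ⊎ σ ≡ -1ℤ → Prime q → ¬ (q ∣ suc b) →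
                  NegativeClass (σ * + (w ℕ.* w ℕ.* (q ℕ.* suc b)))
class-nonsquare σ w q@(suc q-1) b-1 σ≡±1 qp q∤b with prime⇒base qp
... | e , εe , u₀⟂q = Q , a , s≤s z≤n , ⟂-sym a⟂2Q , sign
  where
  b Q : ℕ
  b = suc b-1
  Q = 2 ℕ.* (q ℕ.* b)
  q⟂b : + q ⟂ + b
  q⟂b = prime-∤⇒⟂ qp (q∤b ∘ ∣⇒∣ᵤ)
  sol : ∃ λ x → x ≋ + e [ + q ] × x ≋ 0ℤ [ + b ]
  sol = crt q⟂b (+ e) 0ℤ
  y a : ℕ
  y = proj₁ sol ℤ.%ℕ (q ℕ.* b)
  a = 2 ℕ.* y
  y≋e : + y ≋ + e [ + q ]
  y≋e = mod-%ℕ (proj₁ sol) (q ℕ.* b) (+∣+ (∣.m∣m*n b)) (proj₁ (proj₂ sol))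
  y≋0 : + y ≋ 0ℤ [ + b ]
  y≋0 = mod-%ℕ (proj₁ sol) (q ℕ.* b) (+∣+ (∣.n∣m*n q)) (proj₂ (proj₂ sol))
  double : ∀ {u i j} → + i ≋ + j [ + u ] → + (2 ℕ.* i) ≋ + (2 ℕ.* j) [ + (2 ℕ.* u) ]
  double {u} {i} {j} (mod (divides k eq)) = mod (divides k (begin
    + (2 ℕ.* i) - + (2 ℕ.* j)   ≡⟨ cong₂ _-_ (ℤ.pos-* 2 i) (ℤ.pos-* 2 j) ⟩
    + 2 * + i - + 2 * + j       ≡⟨ lemma (+ i) (+ j) ⟩
    + 2 * (+ i - + j)           ≡⟨ cong (+ 2 *_) eq ⟩
    + 2 * (k * + u)             ≡⟨ lemma′ k (+ u) ⟩
    k * (+ 2 * + u)             ≡⟨ cong (k *_) (sym (ℤ.pos-* 2 u)) ⟩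
    k * + (2 ℕ.* u)             ∎))
    where
    open ≡-Reasoning
    lemma : ∀ i j → + 2 * i - + 2 * j ≡ + 2 * (i - j)
    lemma = solve-∀
    lemma′ : ∀ k u → + 2 * (k * u) ≡ k * (+ 2 * u)
    lemma′ = solve-∀
  a⟂q : + odd a ⟂ + q
  a⟂q = ⟂-sym (⟂-mod (odd-mod {+ q} {2 ℕ.* e} {a} (≋-sym (mod-∣ (+∣+ (∣.n∣m*n 2)) (double y≋e)))) (⟂-sym u₀⟂q))
  a⟂b : + odd a ⟂ + b
  a⟂b = ⟂-sym (⟂-mod (odd-mod {+ b} {0} {a} (≋-sym (mod-∣ (+∣+ (∣.n∣m*n 2)) (double {b} {y} {0} y≋0)))) (⟂-1 (+ b)))
  a⟂2Q : + odd a ⟂ + (2 ℕ.* Q)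
  a⟂2Q = subst (+ odd a ⟂_) (sym pos-2Q) (⟂-* (odd⟂2 a) (⟂-* (odd⟂2 a) (⟂-* a⟂q a⟂b)))
    where
    pos-2Q : + (2 ℕ.* Q) ≡ + 2 * (+ 2 * (+ q * + b))
    pos-2Q = trans (ℤ.pos-* 2 Q) (cong (+ 2 *_) (trans (ℤ.pos-* 2 (q ℕ.* b)) (cong (+ 2 *_) (ℤ.pos-* q b))))
  expand : + (w ℕ.* w ℕ.* (q ℕ.* b)) ≡ + w * + w * (+ q * + b)
  expand = trans (ℤ.pos-* (w ℕ.* w) (q ℕ.* b)) (cong₂ _*_ (ℤ.pos-* w w) (ℤ.pos-* q b))
  sign : ∀ h → + h ≋ + a [ + Q ] → + odd h ⟂ σ * + (w ℕ.* w ℕ.* (q ℕ.* b)) → ε h (σ * + (w ℕ.* w ℕ.* (q ℕ.* b))) ≡ -1ℤ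
  sign h p c = begin
    ε h (σ * + (w ℕ.* w ℕ.* (q ℕ.* b)))               ≡⟨ cong (λ t → ε h (σ * t)) expand ⟩
    ε h (σ * (+ w * + w * (+ q * + b)))               ≡⟨ ε-* {h} {σ} {+ w * + w * (+ q * + b)} u⟂σ u⟂wwqb ⟩
    ε h σ * ε h (+ w * + w * (+ q * + b))             ≡⟨ cong (ε h σ *_) (ε-* {h} {+ w * + w} {+ q * + b} (⟂-* u⟂w u⟂w) (⟂-* u⟂q u⟂b)) ⟩
    ε h σ * (ε h (+ w * + w) * ε h (+ q * + b))       ≡⟨ cong (λ t → ε h σ * (ε h (+ w * + w) * t)) (ε-* {h} {+ q} {+ b} u⟂q u⟂b) ⟩
    ε h σ * (ε h (+ w * + w) * (ε h (+ q) * ε h (+ b)))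
      ≡⟨ cong₂ _*_ (ε-σ σ≡±1) (cong₂ _*_ (ε-square {h} {+ w} u⟂w) (cong₂ _*_ ε-q ε-b)) ⟩
    -1ℤ                                               ∎
    where
    open ≡-Reasoning
    u⟂wwqb : + odd h ⟂ + w * + w * (+ q * + b)
    u⟂wwqb = subst (+ odd h ⟂_) expand (⟂-*⁻ σ c)
    u⟂qb : + odd h ⟂ + q * + b
    u⟂qb = ⟂-*⁻ (+ w * + w) u⟂wwqb
    u⟂b : + odd h ⟂ + b
    u⟂b = ⟂-*⁻ (+ q) u⟂qb
    u⟂q : + odd h ⟂ + q
    u⟂q = ⟂-*⁻ (+ b) (subst (+ odd h ⟂_) (ℤ.*-comm (+ q) (+ b)) u⟂qb)
    u⟂w : + odd h ⟂ + w
    u⟂w = ⟂-*⁻ (+ w) (⟂-*⁻ (+ q * + b) (subst (+ odd h ⟂_) (ℤ.*-comm (+ w * + w) (+ q * + b)) u⟂wwqb))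
    u⟂σ : + odd h ⟂ σ
    u⟂σ = [ (λ { refl → ⟂-1 (+ odd h) }) , (λ { refl → ⟂-neg1 (+ odd h) }) ]′ σ≡±1
    ε-q : ε h (+ q) ≡ -1ℤ
    ε-q = trans (ε-periodic q-1 {h} {2 ℕ.* e}
      (≋-trans (mod-∣ (+∣+ (∣.*-monoʳ-∣ {q} {q ℕ.* b} 2 (∣.m∣m*n b))) p) (double y≋e))) εe
    -- The comparison is with h = 0, that is, modulus 1, where the product defining the sign is
    -- empty.
    ε-b : ε h (+ b) ≡ 1ℤ
    ε-b = ε-periodic b-1 {h} {0} (≋-trans (mod-∣ (+∣+ (∣.*-monoʳ-∣ {b} {q ℕ.* b} 2 (∣.n∣m*n q))) p) (double {b} {y} {0} y≋0))
    h-even : + h ≋ 0ℤ [ + 2 ]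
    h-even = ≋-trans (mod-∣ (+∣+ (∣.m∣m*n (q ℕ.* b))) p) (∣⇒≋0 (+∣+ (∣.m∣m*n y)))
    ε-σ : σ ≡ 1ℤ ⊎ σ ≡ -1ℤ → ε h σ ≡ 1ℤ
    ε-σ (inj₁ refl) = ε-1 {h}
    ε-σ (inj₂ refl) = trans (ε-neg1 h) (even-from-mod h-even)

negative-class : ∀ {n} → n ≢ 0ℤ → ¬ IsPerfectSquare n → NegativeClass n
negative-class {n} n≢0 nonsquare = by-cases (square-or-nonsquare ℤ.∣ n ∣ (ℕ.n≢0⇒n>0 (n≢0 ∘ ℤ.∣i∣≡0⇒i≡0)))
  where
  signed : ∀ n → ∃ λ σ → (σ ≡ 1ℤ ⊎ σ ≡ -1ℤ) × n ≡ σ * + ℤ.∣ n ∣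
  signed (+ k)      = 1ℤ , inj₁ refl , sym (ℤ.*-identityˡ (+ k))
  signed (-[1+ k ]) = -1ℤ , inj₂ refl , sym (ℤ.-1*i≡-i (+ suc k))
  by-cases : (∃ λ m → ℤ.∣ n ∣ ≡ m ℕ.* m) ⊎ NonSquarePart ℤ.∣ n ∣ → NegativeClass n
  by-cases c with signed n
  by-cases (inj₁ (m , eq)) | _ , inj₁ refl , n≡ =
    ⊥-elim (nonsquare (+ m , trans n≡ (trans (ℤ.*-identityˡ _) (trans (cong +_ eq) (ℤ.pos-* m m)))))
  by-cases (inj₁ (m , eq)) | _ , inj₂ refl , n≡ =
    subst NegativeClass (sym (trans n≡ (cong (λ t → -1ℤ * + t) eq))) (class-minus-square m)
  by-cases (inj₂ (w , q , zero , qp , q∤b , eq)) | _ = ⊥-elim (q∤b (q ∣.∣0))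
  by-cases (inj₂ (w , q , suc b , qp , q∤b , eq)) | σ , σ≡±1 , n≡ =
    subst NegativeClass (sym (trans n≡ (cong (λ t → σ * + t) eq))) (class-nonsquare σ w q b σ≡±1 qp q∤b)

-- With N the absolute value of n, some u < 2Q N D P in the negative class is coprime to N D P. Were
-- n a square modulo u, its sign would be 1; hence u has an inert prime factor, and K = 2Q N D
-- bounds it.
inert-primes : ∀ {n} → n ≢ 0ℤ → ¬ IsPerfectSquare n → ∀ D → 1 ≤ D →
  ∃ λ K → ∀ P → 1 ≤ P → ∃ λ p → Prime p × p ≤ K ℕ.* P × ¬ (p ∣ D) × ¬ (p ∣ P) × InertAt n p
inert-primes {n} n≢0 nonsquare D 1≤D with negative-class n≢0 nonsquare
... | Q , a , 1≤Q , 2Q⟂a , negative = 2 ℕ.* Q ℕ.* (ℤ.∣ n ∣ ℕ.* D) , find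
  where
  N : ℕ
  N = ℤ.∣ n ∣
  1≤N : 1 ≤ N
  1≤N = ℕ.n≢0⇒n>0 (n≢0 ∘ ℤ.∣i∣≡0⇒i≡0)
  find : ∀ P → 1 ≤ P → ∃ λ p → Prime p × p ≤ 2 ℕ.* Q ℕ.* (N ℕ.* D) ℕ.* P × ¬ (p ∣ D) × ¬ (p ∣ P) × InertAt n p
  find P 1≤P with coprime-in-progression (2 ℕ.* Q) (ℕ.*-mono-≤ {1} {2} (s≤s z≤n) 1≤Q) 2Q⟂a
                    (N ℕ.* D ℕ.* P) (ℕ.*-mono-≤ (ℕ.*-mono-≤ 1≤N 1≤D) 1≤P)
  ... | u , u< , u≋a , u⟂NDP = conclude (inert-or-square n u 1≤u u⟂2 u⟂n)
    where
    h : ℕ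
    h = u / 2
    u%2≡1 : u ℕ.% 2 ≡ 1
    u%2≡1 = ≋-small⇒≡ (ℕ.m%n<n u 2) ℕ.≤-refl
      (≋-trans (%ℕ-mod (+ u) 2) (≋-trans (mod-∣ (+∣+ (∣.m∣m*n Q)) u≋a)
        (≋-trans (≋-reflexive (+odd a)) (≋-trans (+-mod (≋-refl {a = 1ℤ}) (∣⇒≋0 (∣ℤ.∣m⇒∣m*n (+ a) ∣ℤ.∣-refl))) ≋-refl))))
    u≡odd : u ≡ odd h
    u≡odd = trans (ℕ.m≡m%n+[m/n]*n u 2) (cong₂ ℕ._+_ u%2≡1 (ℕ.*-comm h 2))
    1≤u : 1 ≤ u
    1≤u = subst (1 ≤_) (sym u≡odd) (s≤s z≤n)
    u⟂2 : + u ⟂ + 2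
    u⟂2 = subst (λ t → + t ⟂ + 2) (sym u≡odd) (odd⟂2 h)
    u⟂ : ∀ k → k ∣ N ℕ.* D ℕ.* P → + u ⟂ + k
    u⟂ k d = ⟂-∣ (+∣+ d) u⟂NDP
    u⟂n : + u ⟂ n
    u⟂n = ⟂-∣ ∣ℤ.m∣∣m∣ (u⟂ N (∣.∣m⇒∣m*n P (∣.m∣m*n D)))
    h≋a : + h ≋ + a [ + Q ]
    h≋a = mod (∣ℤ.*-cancelˡ-∣ (+ 2) (subst₂ _∣ℤ_ (ℤ.pos-* 2 Q) equation (difference u≋a)))
      where
      lemma : ∀ h a → 1ℤ + + 2 * h - (1ℤ + + 2 * a) ≡ + 2 * (h - a)
      lemma = solve-∀
      equation : + u - + odd a ≡ + 2 * (+ h - + a)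
      equation = trans (cong₂ _-_ (trans (cong +_ u≡odd) (+odd h)) (+odd a)) (lemma (+ h) (+ a))
    p∤ : ∀ {p k} → Prime p → p ∣ u → k ∣ N ℕ.* D ℕ.* P → ¬ (p ∣ k)
    p∤ {p} {k} pp p∣u d p∣k = ⟂-prime-∤ pp (⟂-sym (⟂-∣ (+∣+ p∣u) (⟂-sym (u⟂ k d)))) (+∣+ p∣k)
    conclude : (∃ λ p → Prime p × p ∣ u × InertAt n p) ⊎ (∃ λ t → + u ∣ℤ t * t - n) →
               ∃ λ p → Prime p × p ≤ 2 ℕ.* Q ℕ.* (N ℕ.* D) ℕ.* P × ¬ (p ∣ D) × ¬ (p ∣ P) × InertAt n p
    conclude (inj₁ (p , pp , p∣u , inert)) = p , pp ,
      ℕ.≤-trans (∣.∣⇒≤ {{ℕ.>-nonZero 1≤u}} p∣u) (ℕ.≤-trans (ℕ.<⇒≤ u<) (ℕ.≤-reflexive (sym (ℕ.*-assoc (2 ℕ.* Q) (N ℕ.* D) P)))) ,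
      p∤ pp p∣u (∣.∣m⇒∣m*n P (∣.n∣m*n N)) , p∤ pp p∣u (∣.n∣m*n (N ℕ.* D)) , inert
    conclude (inj₂ (t , d)) = contradiction (trans (sym (negative h h≋a h⟂n)) ε≡1) λ ()
      where
      h⟂n : + odd h ⟂ n
      h⟂n = subst (λ z → + z ⟂ n) u≡odd u⟂n
      n≋t² : n ≋ t * t [ + odd h ]
      n≋t² = ≋-sym (mod (subst (λ z → + z ∣ℤ t * t - n) u≡odd d))
      ε≡1 : ε h n ≡ 1ℤ
      ε≡1 = trans (ε-mod {h} h⟂n n≋t²) (ε-square {h} {t} (⟂-*⁻ t (⟂-mod n≋t² h⟂n)))

-- Vanishing power sums modulo a prime

sum-linear : ∀ {n} (f g : Fin n → ℤ) k → sumℤ (λ i → f i + k * g i) ≡ sumℤ f + k * sumℤ g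
sum-linear {zero}  f g k = lemma k
  where
  lemma : ∀ k → 0ℤ ≡ 0ℤ + k * 0ℤ
  lemma = solve-∀
sum-linear {suc n} f g k = trans (cong (λ t → f zero + k * g zero + t) (sum-linear (f ∘ suc) (g ∘ suc) k))
  (lemma (f zero) (g zero) (sumℤ (f ∘ suc)) (sumℤ (g ∘ suc)) k)
  where
  lemma : ∀ a b c d k → a + k * b + (c + k * d) ≡ a + c + k * (b + d)
  lemma = solve-∀

sum-*ˡ : ∀ {n} k (g : Fin n → ℤ) → sumℤ (λ i → k * g i) ≡ k * sumℤ g
sum-*ˡ {zero}  k g = sym (ℤ.*-zeroʳ k)
sum-*ˡ {suc n} k g = trans (cong (λ t → k * g zero + t) (sum-*ˡ k (g ∘ suc))) (sym (ℤ.*-distribˡ-+ k (g zero) (sumℤ (g ∘ suc))))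

sum-0 : ∀ {n} (f : Fin n → ℤ) → (∀ i → f i ≡ 0ℤ) → sumℤ f ≡ 0ℤ
sum-0 {zero}  f p = refl
sum-0 {suc n} f p = cong₂ _+_ (p zero) (sum-0 (f ∘ suc) (p ∘ suc))

prod-0 : ∀ {n} (f : Fin n → ℤ) i → f i ≡ 0ℤ → prodℤ f ≡ 0ℤ
prod-0 f zero    p = trans (cong (_* prodℤ (f ∘ suc)) p) (ℤ.*-zeroˡ (prodℤ (f ∘ suc)))
prod-0 f (suc i) p = trans (cong (f zero *_) (prod-0 (f ∘ suc) i p)) (ℤ.*-zeroʳ (f zero))

∥_∥ : ∀ {n} → (Fin n → ℤ) → ℕ
∥_∥ {zero}  c = 0
∥_∥ {suc n} c = ℤ.∣ c zero ∣ ℕ.+ ∥ c ∘ suc ∥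

∣c∣≤∥c∥ : ∀ {n} (c : Fin n → ℤ) i → ℤ.∣ c i ∣ ≤ ∥ c ∥
∣c∣≤∥c∥ c zero    = ℕ.m≤m+n _ _
∣c∣≤∥c∥ c (suc i) = ℕ.≤-trans (∣c∣≤∥c∥ (c ∘ suc) i) (ℕ.m≤n+m _ _)

∣sum∣≤ : ∀ {n} (c f : Fin n → ℤ) B → (∀ i → ℤ.∣ f i ∣ ≤ ℤ.∣ c i ∣ ℕ.* B) → ℤ.∣ sumℤ f ∣ ≤ ∥ c ∥ ℕ.* B
∣sum∣≤ {zero}  c f B p = z≤n
∣sum∣≤ {suc n} c f B p = ℕ.≤-trans (ℤ.∣i+j∣≤∣i∣+∣j∣ (f zero) (sumℤ (f ∘ suc)))
  (ℕ.≤-trans (ℕ.+-mono-≤ (p zero) (∣sum∣≤ (c ∘ suc) (f ∘ suc) B (p ∘ suc)))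
             (ℕ.≤-reflexive (sym (ℕ.*-distribʳ-+ B ℤ.∣ c zero ∣ ∥ c ∘ suc ∥))))

sumOver-levelSet : ∀ {s} (c x : Fin s → ℤ) i →
  sumOver (levelSet x i) c ≡ sumℤ (λ k → if does (x i ℤ.≟ x k) then c k else 0ℤ)
sumOver-levelSet c x i = sumℤ-cong λ k → cong (if_then c k else 0ℤ) (lookup∘tabulate (λ j → does (x i ℤ.≟ x j)) k)

∣sumOver∣≤ : ∀ {s} (c x : Fin s → ℤ) i → ℤ.∣ sumOver (levelSet x i) c ∣ ≤ ∥ c ∥
∣sumOver∣≤ c x i = ℕ.≤-trans (∣sum∣≤ c _ 1 bound) (ℕ.≤-reflexive (ℕ.*-identityʳ ∥ c ∥))
  where
  if-bound : ∀ b z → ℤ.∣ if b then z else 0ℤ ∣ ≤ ℤ.∣ z ∣ ℕ.* 1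
  if-bound false z = z≤n
  if-bound true  z = ℕ.≤-reflexive (sym (ℕ.*-identityʳ ℤ.∣ z ∣))
  bound : ∀ k → ℤ.∣ if lookup (levelSet x i) k then c k else 0ℤ ∣ ≤ ℤ.∣ c k ∣ ℕ.* 1
  bound k = if-bound (lookup (levelSet x i) k) (c k)

PowerSumsVanish : ∀ {s} → ℤ → ℕ → (c x : Fin s → ℤ) → Set
PowerSumsVanish m d c x = ∀ j → j ≤ d → m ∣ℤ sumℤ (λ i → c i * x i ^ j)

-- The power sums vanish on all monomials up to degree d, hence on every polynomial of degree at
-- most d. The form with prescribed roots w serves to switch off chosen terms of the sum.
vanish-on-products : ∀ {s m d} (c x : Fin s → ℤ) → PowerSumsVanish m d c x →
  ∀ {e} (w : Fin e → ℤ) → e ≤ d → m ∣ℤ sumℤ (λ i → c i * prodℤ (λ k → x i - w k))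
vanish-on-products {m = m} {d} c x vanish {e} w e≤d =
  subst (m ∣ℤ_) (sumℤ-cong λ i → cong (c i *_) (ℤ.*-identityˡ _)) (go w 0 (subst (_≤ d) (sym (ℕ.+-identityʳ e)) e≤d))
  where
  go : ∀ {e} (w : Fin e → ℤ) j → e ℕ.+ j ≤ d → m ∣ℤ sumℤ (λ i → c i * (x i ^ j * prodℤ (λ k → x i - w k)))
  go {zero}  w j j≤d = subst (m ∣ℤ_) (sumℤ-cong λ i → cong (c i *_) (sym (ℤ.*-identityʳ (x i ^ j)))) (vanish j j≤d)
  go {suc e} w j e+j≤d = subst (m ∣ℤ_) (sym expand)
    (∣ℤ.∣m∣n⇒∣m+n (go (w ∘ suc) (suc j) (subst (_≤ d) (sym (ℕ.+-suc e j)) e+j≤d))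
                  (∣ℤ.∣n⇒∣m*n (- w zero) (go (w ∘ suc) j (ℕ.<⇒≤ e+j≤d))))
    where
    P : Fin _ → ℤ
    P i = prodℤ (λ k → x i - w (suc k))
    lemma : ∀ c y w z p → c * (y * ((z - w) * p)) ≡ c * (z * y * p) + - w * (c * (y * p))
    lemma = solve-∀
    expand : sumℤ (λ i → c i * (x i ^ j * prodℤ (λ k → x i - w k))) ≡
             sumℤ (λ i → c i * (x i ^ suc j * P i)) + - w zero * sumℤ (λ i → c i * (x i ^ j * P i))
    expand = trans (sumℤ-cong λ i → lemma (c i) (x i ^ j) (w zero) (x i) (P i))
                   (sum-linear (λ i → c i * (x i ^ suc j * P i)) (λ i → c i * (x i ^ j * P i)) (- w zero))

-- The derivative at x a of the polynomial with roots x k, and so a factor of the discriminant.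
D : ∀ {n} → (Fin (suc n) → ℤ) → Fin (suc n) → ℤ
D x a = prodℤ λ k → x a - x (punchIn a k)

vandermonde : ∀ {n} → (Fin (suc n) → ℤ) → ℤ
vandermonde {zero}  x = 1ℤ
vandermonde {suc n} x = D x zero * vandermonde (x ∘ suc)

-- Equals (-1)^(n(n+1)/2), the exponent being the number of pairs among n + 1 points.
discriminantSign : ℕ → ℤ
discriminantSign zero    = 1ℤ
discriminantSign (suc n) = -1ℤ ^ suc n * discriminantSign n

prod-neg : ∀ {n} (f g : Fin n → ℤ) → prodℤ (λ i → f i - g i) ≡ -1ℤ ^ n * prodℤ (λ i → g i - f i)
prod-neg {zero}  f g = refl
prod-neg {suc n} f g = trans (cong (λ t → (f zero - g zero) * t) (prod-neg (f ∘ suc) (g ∘ suc)))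
  (lemma (f zero) (g zero) (-1ℤ ^ n) _)
  where
  lemma : ∀ f g s p → (f - g) * (s * p) ≡ -1ℤ * s * ((g - f) * p)
  lemma = solve-∀

discriminant : ∀ {n} (x : Fin (suc n) → ℤ) → prodℤ (D x) ≡ discriminantSign n * (vandermonde x * vandermonde x)
discriminant {zero}  x = refl
discriminant {suc n} x = begin
  D x zero * prodℤ (λ b → (x (suc b) - x zero) * D (x ∘ suc) b)
    ≡⟨ cong (D x zero *_) (Π.∑-distrib-+ (λ b → x (suc b) - x zero) (D (x ∘ suc))) ⟩
  D x zero * (prodℤ (λ b → x (suc b) - x zero) * prodℤ (D (x ∘ suc)))
    ≡⟨ cong₂ (λ y z → D x zero * (y * z)) (prod-neg (x ∘ suc) (λ _ → x zero)) (discriminant (x ∘ suc)) ⟩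
  D x zero * (-1ℤ ^ suc n * D x zero * (discriminantSign n * (vandermonde (x ∘ suc) * vandermonde (x ∘ suc))))
    ≡⟨ lemma (D x zero) (-1ℤ ^ suc n) (discriminantSign n) (vandermonde (x ∘ suc)) ⟩
  -1ℤ ^ suc n * discriminantSign n * (D x zero * vandermonde (x ∘ suc) * (D x zero * vandermonde (x ∘ suc))) ∎
  where
  open ≡-Reasoning
  lemma : ∀ d s t v → d * (s * d * (t * (v * v))) ≡ s * t * (d * v * (d * v))
  lemma = solve-∀

-- For s = 2t + 2 points this is (-1)^(s/2), the sign in the theorem: passing from t to t + 1
-- multiplies by two consecutive powers of -1, one of them odd.
discriminantSign-odd : ∀ t → discriminantSign (suc (t ℕ.* 2)) ≡ -1ℤ ^ suc t
discriminantSign-odd zero    = refl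
discriminantSign-odd (suc t) = begin
  -1ℤ * (-1ℤ * (-1ℤ * s)) * (-1ℤ * (-1ℤ * s) * discriminantSign (suc (t ℕ.* 2)))
    ≡⟨ cong₂ (λ y z → -1ℤ * (-1ℤ * (-1ℤ * y)) * (-1ℤ * (-1ℤ * y) * z)) s≡1 (discriminantSign-odd t) ⟩
  -1ℤ * (1ℤ * -1ℤ ^ suc t)
    ≡⟨ cong (-1ℤ *_) (ℤ.*-identityˡ (-1ℤ ^ suc t)) ⟩
  -1ℤ * -1ℤ ^ suc t ∎
  where
  open ≡-Reasoning
  s : ℤ
  s = -1ℤ ^ (t ℕ.* 2)
  s≡1 : s ≡ 1ℤ
  s≡1 = trans (cong (-1ℤ ^_) (ℕ.*-comm t 2)) (-1^even t)

punchIn-surjective : ∀ {n} {i j : Fin (suc n)} → i ≢ j → ∃ λ k → punchIn i k ≡ j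
punchIn-surjective i≢j = punchOut i≢j , Fin.punchIn-punchOut i≢j

vandermonde-⟂ : ∀ {u n} (x : Fin (suc n) → ℤ) → (∀ i j → i ≢ j → u ⟂ x i - x j) → u ⟂ vandermonde x
vandermonde-⟂ {u} {zero}  x p = ⟂-1 u
vandermonde-⟂ {u} {suc n} x p = ⟂-* (prod-⟂ _ λ k → p zero (suc k) λ ())
  (vandermonde-⟂ (x ∘ suc) λ i j i≢j → p (suc i) (suc j) (i≢j ∘ Fin.suc-injective))

module _ {d : ℕ} {c x : Fin (suc (suc d)) → ℤ} {m : ℤ} (vanish : PowerSumsVanish m d c x) where

  -- Use the polynomial whose d roots are all points except x zero and x (suc b): two terms survive.
  -- Multiplying by the difference of these two points completes both products to `D`.
  weights-agree : ∀ b → c (suc b) * D x (suc b) ≋ c zero * D x zero [ m ]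
  weights-agree b = mod (subst (m ∣ℤ_) equation (∣ℤ.∣n⇒∣m*n (x (suc b) - x zero) m∣two))
    where
    w : Fin d → ℤ
    w k = x (suc (punchIn b k))
    F : Fin (suc (suc d)) → ℤ
    F i = prodℤ (λ k → x i - w k)
    two : sumℤ (λ i → c i * F i) ≡ c zero * F zero + c (suc b) * F (suc b)
    two = cong (λ t → c zero * F zero + t)
      (trans (Σ.sum-remove {i = b} (λ i → c (suc i) * F (suc i)))
        (trans (cong (λ t → c (suc b) * F (suc b) + t) (sum-0 _ λ k →
                  trans (cong (c (suc (punchIn b k)) *_)
                          (prod-0 (λ l → x (suc (punchIn b k)) - w l) k (ℤ.+-inverseʳ (w k))))
                        (ℤ.*-zeroʳ (c (suc (punchIn b k))))))
               (ℤ.+-identityʳ _)))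
    m∣two : m ∣ℤ c zero * F zero + c (suc b) * F (suc b)
    m∣two = subst (m ∣ℤ_) two (vanish-on-products c x vanish w ℕ.≤-refl)
    D₀ : D x zero ≡ (x zero - x (suc b)) * F zero
    D₀ = Π.sum-remove {i = b} (λ k → x zero - x (suc k))
    lemma : ∀ y z c₀ c₁ f₀ f₁ → (y - z) * (c₀ * f₀ + c₁ * f₁) ≡ c₁ * ((y - z) * f₁) - c₀ * ((z - y) * f₀)
    lemma = solve-∀
    equation : (x (suc b) - x zero) * (c zero * F zero + c (suc b) * F (suc b)) ≡
               c (suc b) * D x (suc b) - c zero * D x zero
    equation = trans (lemma (x (suc b)) (x zero) (c zero) (c (suc b)) (F zero) (F (suc b)))
      (cong (λ t → c (suc b) * D x (suc b) - c zero * t) (sym D₀))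

  weights-product : prodℤ c * (discriminantSign (suc d) * (vandermonde x * vandermonde x)) ≋ (c zero * D x zero) ^ suc (suc d) [ m ]
  weights-product = ≋-trans (≋-reflexive (trans (cong (prodℤ c *_) (sym (discriminant x))) (sym (Π.∑-distrib-+ c (D x)))))
    (≋-trans (prod-mod all-agree) (≋-reflexive (prod-const {suc (suc d)} (λ _ → c zero * D x zero) _ (λ _ → refl))))
    where
    all-agree : ∀ a → c a * D x a ≋ c zero * D x zero [ m ]
    all-agree zero    = ≋-refl
    all-agree (suc b) = weights-agree b

  -- Two of the s indices, i and b, are spared, leaving d = s - 2 roots. By the covering hypothesis
  -- these still include every value other than x i, so the polynomial kills all terms off the level
  -- set of i. On that level set it is a constant prime to p, which can be cancelled.
  level-isolated : ∀ {p} → m ≡ + p → Prime p → (∀ i j → x i ≋ x j [ m ] → x i ≡ x j) →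
    ∀ i b → i ≢ b → (∀ k → x i ≢ x k → ∃ λ l → i ≢ l × b ≢ l × x l ≡ x k) →
    m ∣ℤ sumOver (levelSet x i) c
  level-isolated {p} refl pp reduced i b i≢b cover =
    subst (m ∣ℤ_) (sym (sumOver-levelSet c x i)) (≋0⇒∣ (⟂-cancelˡ {m} {F i} F⟂
      (≋-trans (≋-reflexive (sym (sum-*ˡ (F i) level)))
        (≋-trans (sum-mod (λ k → ≋-reflexive (sym (isolate k))))
          (≋-trans (∣⇒≋0 (vanish-on-products c x vanish w ℕ.≤-refl)) (≋-reflexive (sym (ℤ.*-zeroʳ (F i)))))))))
    where
    b′ : Fin (suc d)
    b′ = punchOut i≢b
    remaining : Fin d → Fin (suc (suc d))
    remaining k = punchIn i (punchIn b′ k)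
    remaining-surjective : ∀ l → i ≢ l → b ≢ l → ∃ λ k → remaining k ≡ l
    remaining-surjective l i≢l b≢l with punchIn-surjective {i = b′} {punchOut i≢l} (b≢l ∘ Fin.punchOut-injective i≢b i≢l)
    ... | k , eq = k , trans (cong (punchIn i) eq) (Fin.punchIn-punchOut i≢l)
    -- Points of the level set of i are moved off it, to keep the product nonzero at i.
    avoid : ℤ → ℤ
    avoid z = if does (x i ℤ.≟ z) then x i + 1ℤ else z
    avoid-other : ∀ {z} → x i ≢ z → avoid z ≡ z
    avoid-other {z} ne rewrite dec-false (x i ℤ.≟ z) ne = refl
    w : Fin d → ℤ
    w k = avoid (x (remaining k))
    F level : Fin (suc (suc d)) → ℤ
    F k = prodℤ (λ l → x k - w l)
    level k = if does (x i ℤ.≟ x k) then c k else 0ℤ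
    isolate : ∀ k → c k * F k ≡ F i * level k
    isolate k with x i ℤ.≟ x k
    ... | yes eq = trans (cong (λ z → c k * prodℤ (λ l → z - w l)) (sym eq)) (ℤ.*-comm (c k) (F i))
    ... | no ne with cover k ne
    ...   | l , i≢l , b≢l , xl≡xk with remaining-surjective l i≢l b≢l
    ...     | t , refl = trans (cong (c k *_) (prod-0 (λ l → x k - w l) t
                  (trans (cong (λ z → x k - avoid z) xl≡xk) (trans (cong (λ z → x k - z) (avoid-other ne)) (ℤ.+-inverseʳ (x k))))))
                (trans (ℤ.*-zeroʳ (c k)) (sym (ℤ.*-zeroʳ (F i))))
    factor⟂ : ∀ l → m ⟂ x i - avoid (x l)
    factor⟂ l with x i ℤ.≟ x l
    ... | yes _ = subst (m ⟂_) (lemma (x i)) (⟂-neg1 m)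
      where
      lemma : ∀ z → -1ℤ ≡ z - (z + 1ℤ)
      lemma = solve-∀
    ... | no ne = prime-∤⇒⟂ pp (ne ∘ reduced i l ∘ mod)
    F⟂ : m ⟂ F i
    F⟂ = prod-⟂ _ (λ k → factor⟂ (remaining k))

-- A repeated value leaves room for `level-isolated`; distinct values would make n a square. The
-- bound p > Σ|cᵢ| turns divisibility of the level sums into their vanishing.
trivial-mod-prime : ∀ t {c x : Fin (suc t ℕ.* 2) → ℤ} {p} → Prime p → ∥ c ∥ < p →
  InertAt (-1ℤ ^ suc t * prodℤ c) p → (∀ i j → x i ≋ x j [ + p ] → x i ≡ x j) →
  PowerSumsVanish (+ p) (t ℕ.* 2) c x → Trivial c x
trivial-mod-prime t {c} {x} {p} pp c<p inert reduced vanish _ (i , refl) =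
  ∣-small⇒≡0 p∣level (ℕ.≤-<-trans (∣sumOver∣≤ c x i) c<p)
  where
  distinct-absurd : (∀ i j → i ≢ j → x i ≢ x j) → ⊥
  -- Since s is even, the common weight to the power s is μ², so n V² ≡ μ². Hence μ / V is a square
  -- root of n modulo p.
  distinct-absurd distinct = inert (b * μ) (difference
      (≋-trans (≋-reflexive (lemma₁ b μ)) (≋-trans (*-modˡ (b * b) (≋-sym n∙V²≋μ²))
        (≋-trans (≋-reflexive (lemma₂ b n V)) (≋-trans (*-modˡ n (*-mod bV≋1 bV≋1)) (≋-reflexive (ℤ.*-identityʳ n)))))))
    where
    n V μ : ℤ
    n = -1ℤ ^ suc t * prodℤ c
    V = vandermonde x
    μ = (c zero * D x zero) ^ suc t
    lemma₀ : ∀ a s v → a * (s * v) ≡ s * a * v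
    lemma₀ = solve-∀
    lemma₁ : ∀ b μ → b * μ * (b * μ) ≡ b * b * (μ * μ)
    lemma₁ = solve-∀
    lemma₂ : ∀ b n v → b * b * (n * (v * v)) ≡ n * (b * v * (b * v))
    lemma₂ = solve-∀
    n∙V²≋μ² : n * (V * V) ≋ μ * μ [ + p ]
    n∙V²≋μ² = ≋-trans (≋-reflexive (trans (sym (lemma₀ (prodℤ c) (-1ℤ ^ suc t) (V * V)))
                         (cong (λ z → prodℤ c * (z * (V * V))) (sym (discriminantSign-odd t)))))
      (≋-trans (weights-product {t ℕ.* 2} {c} {x} vanish)
        (≋-reflexive (trans (sym (ℤ.^-*-assoc (c zero * D x zero) (suc t) 2)) (cong (μ *_) (ℤ.*-identityʳ μ)))))
    p⟂V : + p ⟂ V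
    p⟂V = vandermonde-⟂ x λ i j i≢j → prime-∤⇒⟂ pp (distinct i j i≢j ∘ reduced i j ∘ mod)
    b : ℤ
    b = proj₁ (⟂-inverse p⟂V)
    bV≋1 : b * V ≋ 1ℤ [ + p ]
    bV≋1 = proj₂ (⟂-inverse p⟂V)
  -- The spared index is taken from the repeated pair, so its value is still covered by its partner,
  -- unless that partner is i itself and the value is the one being isolated.
  from-repetition : ∀ a b → a ≢ b → x a ≡ x b → + p ∣ℤ sumOver (levelSet x i) c
  from-repetition a b a≢b xa≡xb with i Fin.≟ a | i Fin.≟ b
  ... | yes refl | _ = level-isolated {t ℕ.* 2} {c} {x} vanish refl pp reduced i b a≢b
          λ k ne → k , (λ { refl → ne refl }) , (λ { refl → ne xa≡xb }) , refl
  ... | no i≢a | yes refl = level-isolated {t ℕ.* 2} {c} {x} vanish refl pp reduced i a i≢a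
          λ k ne → k , (λ { refl → ne refl }) , (λ { refl → ne (sym xa≡xb) }) , refl
  ... | no i≢a | no i≢b = level-isolated {t ℕ.* 2} {c} {x} vanish refl pp reduced i b i≢b cover
    where
    cover : ∀ k → x i ≢ x k → ∃ λ l → i ≢ l × b ≢ l × x l ≡ x k
    cover k ne with b Fin.≟ k
    ... | yes refl = a , i≢a , (λ b≡a → a≢b (sym b≡a)) , xa≡xb
    ... | no b≢k   = k , (λ { refl → ne refl }) , b≢k , refl
  p∣level : + p ∣ℤ sumOver (levelSet x i) c
  p∣level with Fin.any? (λ a → Fin.any? (λ b → ¬? (a Fin.≟ b) ×-dec (x a ℤ.≟ x b)))
  ... | yes (a , b , a≢b , eq) = from-repetition a b a≢b eq
  ... | no none = ⊥-elim (distinct-absurd λ a b a≢b eq → none (a , b , a≢b , eq))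

-- Zero-sum partitions

sumℕ : ∀ {n} → (Fin n → ℕ) → ℕ
sumℕ {zero}  f = 0
sumℕ {suc n} f = f zero ℕ.+ sumℕ (f ∘ suc)

sumℕ-mono-≤ : ∀ {n} {f g : Fin n → ℕ} → (∀ i → f i ≤ g i) → sumℕ f ≤ sumℕ g
sumℕ-mono-≤ {zero}  p = z≤n
sumℕ-mono-≤ {suc n} p = ℕ.+-mono-≤ (p zero) (sumℕ-mono-≤ (p ∘ suc))

sumℕ-mono-< : ∀ {n} {f g : Fin n → ℕ} → (∀ i → f i ≤ g i) → ∀ i → f i < g i → sumℕ f < sumℕ g
sumℕ-mono-< p zero    q = ℕ.+-mono-<-≤ q (sumℕ-mono-≤ (p ∘ suc))
sumℕ-mono-< p (suc i) q = ℕ.+-mono-≤-< (p zero) (sumℕ-mono-< (p ∘ suc) i q)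

sumOver-split : ∀ {n} (p q : Subset n) (c : Fin n → ℤ) → q ⊆ p → sumOver p c ≡ sumOver (p ∩ ∁ q) c + sumOver q c
sumOver-split []            []            c q⊆p = refl
sumOver-split (inside  ∷ p) (inside  ∷ q) c q⊆p =
  trans (cong (λ t → c zero + t) (sumOver-split p q (c ∘ suc) (Sub.drop-∷-⊆ q⊆p))) (lemma (c zero) (sumOver (p ∩ ∁ q) (c ∘ suc)) (sumOver q (c ∘ suc)))
  where
  lemma : ∀ a b c → a + (b + c) ≡ 0ℤ + b + (a + c)
  lemma = solve-∀
sumOver-split (inside  ∷ p) (outside ∷ q) c q⊆p =
  trans (cong (λ t → c zero + t) (sumOver-split p q (c ∘ suc) (Sub.drop-∷-⊆ q⊆p))) (lemma (c zero) (sumOver (p ∩ ∁ q) (c ∘ suc)) (sumOver q (c ∘ suc)))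
  where
  lemma : ∀ a b c → a + (b + c) ≡ a + b + (0ℤ + c)
  lemma = solve-∀
sumOver-split (outside ∷ p) (outside ∷ q) c q⊆p =
  trans (cong (λ t → 0ℤ + t) (sumOver-split p q (c ∘ suc) (Sub.drop-∷-⊆ q⊆p))) (lemma (sumOver (p ∩ ∁ q) (c ∘ suc)) (sumOver q (c ∘ suc)))
  where
  lemma : ∀ b c → 0ℤ + (b + c) ≡ 0ℤ + b + (0ℤ + c)
  lemma = solve-∀
sumOver-split (outside ∷ p) (inside  ∷ q) c q⊆p with q⊆p here
... | ()

sumOver-empty : ∀ {n} (p : Subset n) (c : Fin n → ℤ) → (∀ k → k ∉ p) → sumOver p c ≡ 0ℤ
sumOver-empty []            c none = refl
sumOver-empty (inside  ∷ p) c none = ⊥-elim (none zero here)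
sumOver-empty (outside ∷ p) c none = cong (λ t → 0ℤ + t) (sumOver-empty p (c ∘ suc) λ k k∈p → none (suc k) (there k∈p))

module _ {s : ℕ} where

  block : Partition s → Fin s → Subset s
  block 𝒯 i = proj₁ (covers 𝒯 i)

  block-Block : ∀ 𝒯 i → Block 𝒯 (block 𝒯 i)
  block-Block 𝒯 i = proj₁ (proj₁ (proj₂ (covers 𝒯 i)))

  ∈-block : ∀ 𝒯 i → i ∈ block 𝒯 i
  ∈-block 𝒯 i = proj₂ (proj₁ (proj₂ (covers 𝒯 i)))

  block-unique : ∀ 𝒯 {i T} → Block 𝒯 T → i ∈ T → block 𝒯 i ≡ T
  block-unique 𝒯 {i} T∈𝒯 i∈T = proj₂ (proj₂ (covers 𝒯 i)) (T∈𝒯 , i∈T)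

  Refines⇒block⊆ : ∀ (𝒱 𝒰 : Partition s) → 𝒱 Refines 𝒰 → ∀ i → block 𝒱 i ⊆ block 𝒰 i
  Refines⇒block⊆ 𝒱 𝒰 ref i with ref _ (block-Block 𝒱 i)
  ... | U , U∈𝒰 , V⊆U rewrite block-unique 𝒰 U∈𝒰 (V⊆U (∈-block 𝒱 i)) = V⊆U

  Refines-refl : ∀ (𝒰 : Partition s) → 𝒰 Refines 𝒰
  Refines-refl 𝒰 T T∈𝒰 = T , T∈𝒰 , λ i∈T → i∈T

  Refines-trans : ∀ (𝒯 𝒰 𝒱 : Partition s) → 𝒯 Refines 𝒰 → 𝒰 Refines 𝒱 → 𝒯 Refines 𝒱
  Refines-trans 𝒯 𝒰 𝒱 p q T T∈𝒯 with p T T∈𝒯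
  ... | U , U∈𝒰 , T⊆U with q U U∈𝒰
  ... | V , V∈𝒱 , U⊆V = V , V∈𝒱 , λ i∈T → U⊆V (T⊆U i∈T)

  blocks≡⇒≈ₚ : ∀ (𝒱 𝒰 : Partition s) → (∀ i → block 𝒱 i ≡ block 𝒰 i) → 𝒱 ≈ₚ 𝒰
  blocks≡⇒≈ₚ 𝒱 𝒰 eq T = mk⇔ (transfer 𝒱 𝒰 eq) (transfer 𝒰 𝒱 (sym ∘ eq))
    where
    transfer : ∀ 𝒱 𝒰 → (∀ i → block 𝒱 i ≡ block 𝒰 i) → Block 𝒱 T → Block 𝒰 T
    transfer 𝒱 𝒰 eq T∈𝒱 with nonempty 𝒱 T∈𝒱
    ... | i , i∈T = subst (Block 𝒰) (trans (sym (eq i)) (block-unique 𝒱 T∈𝒱 i∈T)) (block-Block 𝒰 i)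

  -- The sum of the squares of the block sizes, a measure that proper refinement decreases.
  size : Partition s → ℕ
  size 𝒰 = sumℕ λ i → ∣ block 𝒰 i ∣

  -- Descent on `size`: if 𝒰 is not finest, some strictly finer zero-sum partition takes its place.
  -- The double negation allows this case distinction without a search through all partitions.
  finest-exists : ∀ (c : Fin s → ℤ) 𝒰 → ZeroSum c 𝒰 → ¬ (∀ ℱ → Finest c ℱ → ¬ (ℱ Refines 𝒰))
  finest-exists c 𝒰 = go 𝒰 (<-wellFounded (size 𝒰))
    where
    go : ∀ 𝒰 → Acc _<_ (size 𝒰) → ZeroSum c 𝒰 → ¬ (∀ ℱ → Finest c ℱ → ¬ (ℱ Refines 𝒰))
    go 𝒰 (acc rec) zs none = none 𝒰 (zs , minimal) (Refines-refl 𝒰)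
      where
      minimal : ∀ 𝒱 → ZeroSum c 𝒱 → 𝒱 Refines 𝒰 → 𝒱 ≈ₚ 𝒰
      minimal 𝒱 zs′ ref
        with Fin.any? (λ i → Fin.any? (λ k → (k Sub.∈? block 𝒰 i) ×-dec ¬? (k Sub.∈? block 𝒱 i)))
      ... | yes (i , k , k∈U , k∉V) = ⊥-elim (go 𝒱 (rec smaller) zs′
              λ ℱ fin ref′ → none ℱ fin (Refines-trans ℱ 𝒱 𝒰 ref′ ref))
        where
        smaller : size 𝒱 < size 𝒰
        smaller = sumℕ-mono-< (λ j → Sub.p⊆q⇒∣p∣≤∣q∣ (Refines⇒block⊆ 𝒱 𝒰 ref j)) i
                    (Sub.p⊂q⇒∣p∣<∣q∣ (Refines⇒block⊆ 𝒱 𝒰 ref i , k , k∈U , k∉V))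
      ... | no same = blocks≡⇒≈ₚ 𝒱 𝒰 λ i → Sub.⊆-antisym (Refines⇒block⊆ 𝒱 𝒰 ref i)
              λ {k} k∈U → decidable-stable (k Sub.∈? block 𝒱 i) λ k∉V → same (i , k , k∈U , k∉V)

  -- Equality of labels is decidable, so the double negation in
  -- finest-exists is harmless.
  primitive-refines : ∀ {c : Fin s → ℤ} (prim : Primitive c) x → Trivial c x → ∀ i k → k ∈ block (proj₁ prim) i → x i ≡ x k
  primitive-refines {c} (𝒯 , _ , unique) x triv i k k∈T = decidable-stable (x i ℤ.≟ x k) λ x≢ →
    finest-exists c (levelPartition x) triv λ ℱ fin ref →
      x≢ (∈-levelSet⁻ x (same-level ℱ ref (Equivalence.to (unique {ℱ} fin (block 𝒯 i)) (block-Block 𝒯 i))))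
    where
    same-level : ∀ ℱ → ℱ Refines levelPartition x → Block ℱ (block 𝒯 i) → k ∈ levelSet x i
    same-level ℱ ref T∈ℱ = Refines⇒block⊆ ℱ (levelPartition x) ref i
      (subst (k ∈_) (sym (block-unique ℱ T∈ℱ (∈-block 𝒯 i))) k∈T)

  -- Such a B is a disjoint union of blocks, which are split off one at a time.
  saturated⇒zeroSum : ∀ {c : Fin s → ℤ} 𝒯 → ZeroSum c 𝒯 → ∀ B → (∀ i k → i ∈ B → k ∈ block 𝒯 i → k ∈ B) → sumOver B c ≡ 0ℤ
  saturated⇒zeroSum {c} 𝒯 zs B = go B (<-wellFounded ∣ B ∣)
    where
    go : ∀ B → Acc _<_ ∣ B ∣ → (∀ i k → i ∈ B → k ∈ block 𝒯 i → k ∈ B) → sumOver B c ≡ 0ℤ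
    go B (acc rec) sat with Sub.nonempty? B
    ... | no empty = sumOver-empty B c λ k k∈B → empty (k , k∈B)
    ... | yes (i , i∈B) = trans (sumOver-split B T c (λ {k} → sat i k i∈B))
            (cong₂ _+_ (go (B ∩ ∁ T) (rec smaller) sat′) (zs T (block-Block 𝒯 i)))
      where
      T : Subset s
      T = block 𝒯 i
      ∉T : ∀ {k} → k ∈ B ∩ ∁ T → k ∉ T
      ∉T k∈ = Sub.x∈∁p⇒x∉p (proj₂ (Sub.x∈p∩q⁻ B (∁ T) k∈))
      smaller : ∣ B ∩ ∁ T ∣ < ∣ B ∣
      smaller = Sub.p⊂q⇒∣p∣<∣q∣ {p = B ∩ ∁ T} {q = B} ((λ {k} → Sub.p∩q⊆p B (∁ T) {k}) , i , i∈B , λ i∈ → ∉T i∈ (∈-block 𝒯 i))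
      sat′ : ∀ j k → j ∈ B ∩ ∁ T → k ∈ block 𝒯 j → k ∈ B ∩ ∁ T
      sat′ j k j∈ k∈ = Sub.x∈p∩q⁺ (sat j k (Sub.p∩q⊆p B (∁ T) j∈) k∈ , Sub.x∉p⇒x∈∁p λ k∈T →
        ∉T j∈ (subst (j ∈_) (trans (sym (block-unique 𝒯 (block-Block 𝒯 j) k∈))
                                   (block-unique 𝒯 (block-Block 𝒯 i) k∈T)) (∈-block 𝒯 j)))

  constant-on-blocks⇒trivial : ∀ {c : Fin s → ℤ} 𝒯 → ZeroSum c 𝒯 → ∀ x → (∀ i k → k ∈ block 𝒯 i → x i ≡ x k) → Trivial c x
  constant-on-blocks⇒trivial 𝒯 zs x const _ (i , refl) = saturated⇒zeroSum 𝒯 zs (levelSet x i)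
    λ j k j∈ k∈ → ∈-levelSet⁺ x (trans (∈-levelSet⁻ x j∈) (const j k k∈))

-- Separating moduli at every scale

module _ (Good Admissible : ℕ → Set) (good-1 : Good 1)
         (good-* : ∀ {p m} → Prime p → Admissible p → ¬ (p ∣ m) → Good m → Good (p ℕ.* m))
         (K : ℕ) (supply : ∀ P → 1 ≤ P → ∃ λ p → Prime p × p ≤ K ℕ.* P × ¬ (p ∣ P) × Admissible p) where

  -- P is the product of the primes found so far. The good m is kept a divisor of P, so that the
  -- next prime, which does not divide P, does not divide m either.
  record Chain (P : ℕ) : Set where
    field
      positive : 1 ≤ P
      reach    : ∀ X → 1 ≤ X → X < K ℕ.* P → ∃ λ m → Good m × 1 ≤ m × m ∣ P × m ≤ X × X < K ℕ.* m

  chain-1 : Chain 1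
  chain-1 = record { positive = ℕ.≤-refl ; reach = λ X 1≤X X<K → 1 , good-1 , ℕ.≤-refl , ∣.∣-refl , 1≤X , X<K }

  -- Scales below K P are served by the old chain. For X ≥ K P, apply the old chain to X / p and
  -- multiply by p; the bound p ≤ K P is what keeps X / p at least 1.
  chain-step : ∀ {P} → Chain P → ∃ λ P′ → P < P′ × Chain P′
  chain-step {P} chain with supply P (Chain.positive chain)
  ... | p@(suc p-1) , pp , p≤KP , p∤P , adm = p ℕ.* P , P<pP , record { positive = ℕ.*-mono-≤ {1} {p} (s≤s z≤n) 1≤P ; reach = reach }
    where
    1≤P : 1 ≤ P
    1≤P = Chain.positive chain
    P<pP : P < p ℕ.* P
    P<pP = ℕ.<-≤-trans (ℕ.m<m*n P p {{ℕ.>-nonZero 1≤P}} (ℕ.nonTrivial⇒n>1 p {{Prime.prime⇒nonTrivial pp}})) (ℕ.≤-reflexive (ℕ.*-comm P p))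
    reach : ∀ X → 1 ≤ X → X < K ℕ.* (p ℕ.* P) → ∃ λ m → Good m × 1 ≤ m × m ∣ p ℕ.* P × m ≤ X × X < K ℕ.* m
    reach X 1≤X X<KpP with X ℕ.<? K ℕ.* P
    ... | yes X<KP with Chain.reach chain X 1≤X X<KP
    ...   | m , good , 1≤m , m∣P , m≤X , X<Km = m , good , 1≤m , ∣.∣n⇒∣m*n p m∣P , m≤X , X<Km
    reach X 1≤X X<KpP | no X≮KP
        with Chain.reach chain (X / p) (ℕ.m≥n⇒m/n>0 (ℕ.≤-trans p≤KP (ℕ.≮⇒≥ X≮KP)))
               (ℕ.m<n*o⇒m/o<n {X} {K ℕ.* P} {p} (subst (X <_) (lemma K p P) X<KpP))
      where
      lemma : ∀ k p q → k ℕ.* (p ℕ.* q) ≡ k ℕ.* q ℕ.* p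
      lemma = ℕSolver.solve-∀
    ... | m , good , 1≤m , m∣P , m≤X/p , X/p<Km =
        p ℕ.* m , good-* pp adm (λ p∣m → p∤P (∣.∣-trans p∣m m∣P)) good , ℕ.*-mono-≤ {1} {p} (s≤s z≤n) 1≤m , ∣.*-monoʳ-∣ p m∣P , pm≤X , X<Kpm
      where
      open ℕ.≤-Reasoning
      lemma : ∀ k p q → k ℕ.* q ℕ.* p ≡ k ℕ.* (p ℕ.* q)
      lemma = ℕSolver.solve-∀
      pm≤X : p ℕ.* m ≤ X
      pm≤X = begin
        p ℕ.* m        ≡⟨ ℕ.*-comm p m ⟩
        m ℕ.* p        ≤⟨ ℕ.*-monoˡ-≤ p m≤X/p ⟩
        X / p ℕ.* p    ≤⟨ ℕ.m/n*n≤m X p ⟩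
        X              ∎
      X<Kpm : X < K ℕ.* (p ℕ.* m)
      X<Kpm = begin-strict
        X                              ≡⟨ ℕ.m≡m%n+[m/n]*n X p ⟩
        X ℕ.% p ℕ.+ X / p ℕ.* p        <⟨ ℕ.+-monoˡ-< (X / p ℕ.* p) (ℕ.m%n<n X p) ⟩
        suc (X / p) ℕ.* p              ≤⟨ ℕ.*-monoˡ-≤ p X/p<Km ⟩
        K ℕ.* m ℕ.* p                  ≡⟨ lemma K p m ⟩
        K ℕ.* (p ℕ.* m)                ∎

  chain-above : ∀ X → ∃ λ P → X < P × Chain P
  chain-above zero = 1 , ℕ.≤-refl , chain-1
  chain-above (suc X) with chain-above X
  ... | P , X<P , chain with chain-step chain
  ... | P′ , P<P′ , chain′ = P′ , ℕ.≤-<-trans X<P P<P′ , chain′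

  good-at-scale : 1 ≤ K → ∀ X → 1 ≤ X → ∃ λ m → Good m × 1 ≤ m × m ≤ X × X < K ℕ.* m
  good-at-scale 1≤K X 1≤X with chain-above X
  ... | P , X<P , chain with Chain.reach chain X 1≤X (ℕ.<-≤-trans X<P (ℕ.m≤n*m P K {{ℕ.>-nonZero 1≤K}}))
  ... | m , good , 1≤m , _ , m≤X , X<Km = m , good , 1≤m , m≤X , X<Km

-- Moduli forcing congruence on the blocks of the finest partition

module _ (t : ℕ) (c : Fin (suc t ℕ.* 2) → ℤ) (prim : Primitive c) where

  -- Referring to one fixed partition, rather than asking for zero-sum level sets, makes the
  -- property pass to products of coprime moduli.
  Separates : ℕ → Set
  Separates m = ∀ x → PowerSumsVanish (+ m) (t ℕ.* 2) c x → ∀ i k → k ∈ block (proj₁ prim) i → x i ≋ x k [ + m ]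

  vanish-∣ : ∀ {u v x} → u ∣ℤ v → PowerSumsVanish v (t ℕ.* 2) c x → PowerSumsVanish u (t ℕ.* 2) c x
  vanish-∣ u∣v vanish j j≤d = ∣ℤ.∣-trans u∣v (vanish j j≤d)

  separates-1 : Separates 1
  separates-1 x _ i k _ = mod (divides (x i - x k) (sym (ℤ.*-identityʳ (x i - x k))))

  separates-prime : ∀ {p} → Prime p → ∥ c ∥ < p → InertAt (-1ℤ ^ suc t * prodℤ c) p → Separates p
  separates-prime {p} pp c<p inert x vanish i k k∈ =
    ≋-trans (≋-sym (%ℕ-mod (x i) p)) (≋-trans (≋-reflexive (primitive-refines {c = c} prim y
      (trivial-mod-prime t {c} {y} pp c<p inert reduced vanish-y) i k k∈)) (%ℕ-mod (x k) p))
    where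
    instance
      p≢0 : ℕ.NonZero p
      p≢0 = Prime.prime⇒nonZero pp
    -- Least residues turn congruence modulo p into equality, so that the level sets of y are
    -- residue classes.
    y : Fin (suc t ℕ.* 2) → ℤ
    y i = + (x i ℤ.%ℕ p)
    reduced : ∀ i j → y i ≋ y j [ + p ] → y i ≡ y j
    reduced i j q = cong +_ (≋-small⇒≡ (ℤ.n%ℕd<d (x i) p) (ℤ.n%ℕd<d (x j) p) q)
    vanish-y : PowerSumsVanish (+ p) (t ℕ.* 2) c y
    vanish-y j j≤d = ≋0⇒∣ (≋-trans (sum-mod {f = λ i → c i * y i ^ j} {g = λ i → c i * x i ^ j} λ i → *-modˡ (c i) (^-mod j (%ℕ-mod (x i) p))) (∣⇒≋0 (vanish j j≤d)))

  separates-* : ∀ {m m′} → + m ⟂ + m′ → Separates m → Separates m′ → Separates (m ℕ.* m′)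
  separates-* {m} {m′} m⟂m′ sep sep′ x vanish i k k∈ =
    mod (subst (_∣ℤ x i - x k) (sym (ℤ.pos-* m m′)) (⟂-*-∣ m⟂m′
      (difference (sep x (vanish-∣ {x = x} (+∣+ (∣.m∣m*n m′)) vanish) i k k∈))
      (difference (sep′ x (vanish-∣ {x = x} (+∣+ (∣.n∣m*n m)) vanish) i k k∈))))

∣-! : ∀ p {n} → 1 ≤ p → p ≤ n → p ∣ n ℕ.!
∣-! (suc p) _ p≤n = ∣.∣-trans (∣.m∣m*n (p ℕ.!)) (∣.m≤n⇒m!∣n! p≤n)

separating-moduli : ∀ t (c : Fin (suc t ℕ.* 2) → ℤ) (prim : Primitive c) → prodℤ c ≢ 0ℤ →
  ¬ IsPerfectSquare (-1ℤ ^ suc t * prodℤ c) →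
  ∃ λ K → 1 ≤ K × ∀ X → 1 ≤ X → ∃ λ m → Separates t c prim m × 1 ≤ m × m ≤ X × X < K ℕ.* m
-- A prime that does not divide the factorial of `∥ c ∥` exceeds `∥ c ∥`, which is how small primes
-- are excluded.
separating-moduli t c prim prod≢0 nonsquare = from-supply (inert-primes n≢0 nonsquare (∥ c ∥ ℕ.!) (ℕ.1≤n! ∥ c ∥))
  where
  n : ℤ
  n = -1ℤ ^ suc t * prodℤ c
  -1^≢0 : ∀ k → -1ℤ ^ k ≢ 0ℤ
  -1^≢0 (suc k) eq = [ (λ ()) , -1^≢0 k ]′ (ℤ.i*j≡0⇒i≡0∨j≡0 -1ℤ eq)
  n≢0 : n ≢ 0ℤ
  n≢0 eq = [ -1^≢0 (suc t) , prod≢0 ]′ (ℤ.i*j≡0⇒i≡0∨j≡0 (-1ℤ ^ suc t) eq)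
  Admissible : ℕ → Set
  Admissible p = ∥ c ∥ < p × InertAt n p
  extend : ∀ {p m} → Prime p → Admissible p → ¬ (p ∣ m) → Separates t c prim m → Separates t c prim (p ℕ.* m)
  extend pp (c<p , inert) p∤m sep =
    separates-* t c prim (prime-∤⇒⟂ pp (p∤m ∘ ∣⇒∣ᵤ)) (separates-prime t c prim pp c<p inert) sep
  1≤prime : ∀ {p} → Prime p → 1 ≤ p
  1≤prime {p} pp = ℕ.>-nonZero⁻¹ p {{Prime.prime⇒nonZero pp}}
  from-supply : (∃ λ K → ∀ P → 1 ≤ P → ∃ λ p → Prime p × p ≤ K ℕ.* P × ¬ (p ∣ ∥ c ∥ ℕ.!) × ¬ (p ∣ P) × InertAt n p) →
    ∃ λ K → 1 ≤ K × ∀ X → 1 ≤ X → ∃ λ m → Separates t c prim m × 1 ≤ m × m ≤ X × X < K ℕ.* m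
  from-supply (K , find) = K , 1≤K , good-at-scale (Separates t c prim) Admissible (separates-1 t c prim) extend K supply 1≤K
    where
    supply : ∀ P → 1 ≤ P → ∃ λ p → Prime p × p ≤ K ℕ.* P × ¬ (p ∣ P) × Admissible p
    supply P 1≤P with find P 1≤P
    ... | p , pp , p≤KP , p∤! , p∤P , inert = p , pp , p≤KP , p∤P ,
      ℕ.≰⇒> (λ p≤c → p∤! (∣-! p (1≤prime pp) p≤c)) , inert
    1≤K : 1 ≤ K
    1≤K with find 1 ℕ.≤-refl
    ... | p , pp , p≤K , _ = ℕ.≤-trans (1≤prime pp) (subst (p ≤_) (ℕ.*-identityʳ K) p≤K)

-- Sets free of nontrivial solutions

image : ∀ {m N} → (Fin m → Fin N) → Subset N
image {zero}  f = ∅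
image {suc m} f = ⁅ f zero ⁆ ∪ image (f ∘ suc)

∈-image⁻ : ∀ {m N} (f : Fin m → Fin N) {k} → k ∈ image f → ∃ λ i → f i ≡ k
∈-image⁻ {zero}  f k∈ = ⊥-elim (Sub.∉⊥ k∈)
∈-image⁻ {suc m} f k∈ with Sub.x∈p∪q⁻ ⁅ f zero ⁆ (image (f ∘ suc)) k∈
... | inj₁ k∈⁅⁆ = zero , sym (Sub.x∈⁅y⁆⇒x≡y (f zero) k∈⁅⁆)
... | inj₂ k∈im with ∈-image⁻ (f ∘ suc) k∈im
...   | i , eq = suc i , eq

∣image∣≥ : ∀ {m N} (f : Fin m → Fin N) → (∀ i j → f i ≡ f j → i ≡ j) → m ≤ ∣ image f ∣
∣image∣≥ {zero}  f inj = z≤n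
∣image∣≥ {suc m} f inj = ℕ.≤-<-trans (∣image∣≥ (f ∘ suc) λ i j eq → Fin.suc-injective (inj (suc i) (suc j) eq))
  (Sub.p⊂q⇒∣p∣<∣q∣ (Sub.q⊆p∪q ⁅ f zero ⁆ (image (f ∘ suc)) , f zero , Sub.x∈p∪q⁺ (inj₁ (Sub.x∈⁅x⁆ (f zero))) , fresh))
  where
  fresh : f zero ∉ image (f ∘ suc)
  fresh k∈ with ∈-image⁻ (f ∘ suc) k∈
  ... | i , eq with inj (suc i) zero eq
  ... | ()

-- Digit expansions of the powers of x

encode : ℕ → ℕ → (ℕ → ℕ) → ℕ
encode M zero    δ = 0
encode M (suc k) δ = δ 0 ℕ.+ M ℕ.* encode M k (δ ∘ suc)

encode< : ∀ M k δ → (∀ j → δ j < M) → encode M k δ < M ℕ.^ k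
encode< M zero    δ δ< = s≤s z≤n
encode< M (suc k) δ δ< = begin-strict
  δ 0 ℕ.+ M ℕ.* encode M k (δ ∘ suc)  <⟨ ℕ.+-monoˡ-< _ (δ< 0) ⟩
  M ℕ.+ M ℕ.* encode M k (δ ∘ suc)    ≡⟨ ℕ.*-suc M _ ⟨
  M ℕ.* suc (encode M k (δ ∘ suc))    ≤⟨ ℕ.*-monoʳ-≤ M (encode< M k (δ ∘ suc) (δ< ∘ suc)) ⟩
  M ℕ.* M ℕ.^ k                       ∎
  where open ℕ.≤-Reasoning

encode-mod : ∀ M k δ → + encode M (suc k) δ ≋ + δ 0 [ + M ]
encode-mod M k δ = ≋-ℕ (encode M k (δ ∘ suc)) (cong (δ 0 ℕ.+_) (ℕ.*-comm M _))

-- The base exceeds Σ|cᵢ| B, so no carries occur: the sum over the lowest digits is a multiple of M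
-- smaller than M in absolute value, hence 0. Dividing by M leaves the same situation for the
-- remaining digits.
digits-vanish : ∀ {s} (c : Fin s → ℤ) B k (δ : Fin s → ℕ → ℕ) → (∀ i j → δ i j ≤ B) →
  let M = suc (∥ c ∥ ℕ.* B) in
  sumℤ (λ i → c i * + encode M k (δ i)) ≡ 0ℤ → ∀ j → j < k → sumℤ (λ i → c i * + δ i j) ≡ 0ℤ
digits-vanish c B (suc k) δ δ≤ sum≡0 = vanishing
  where
  M : ℕ
  M = suc (∥ c ∥ ℕ.* B)
  lowest rest : ℤ
  lowest = sumℤ (λ i → c i * + δ i 0)
  rest   = sumℤ (λ i → c i * + encode M k (δ i ∘ suc))
  lemma : ∀ c d m e → c * (d + m * e) ≡ c * d + m * (c * e)
  lemma = solve-∀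
  split : lowest + + M * rest ≡ 0ℤ
  split = trans (sym (sum-linear (λ i → c i * + δ i 0) (λ i → c i * + encode M k (δ i ∘ suc)) (+ M)))
    (trans (sumℤ-cong λ i → trans (sym (lemma (c i) (+ δ i 0) (+ M) (+ encode M k (δ i ∘ suc))))
                                  (cong (λ z → c i * (+ δ i 0 + z)) (sym (ℤ.pos-* M (encode M k (δ i ∘ suc))))))
           sum≡0)
  lowest≡0 : lowest ≡ 0ℤ
  lowest≡0 = ∣-small⇒≡0 (∣ℤ.∣m+n∣n⇒∣m {n = + M * rest} (subst (+ M ∣ℤ_) (sym split) (divides 0ℤ refl)) (∣ℤ.∣m⇒∣m*n rest ∣ℤ.∣-refl))
    (s≤s (∣sum∣≤ c _ B λ i → ℕ.≤-trans (ℕ.≤-reflexive (ℤ.abs-* (c i) (+ δ i 0))) (ℕ.*-monoʳ-≤ ℤ.∣ c i ∣ (δ≤ i 0))))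
  rest≡0 : rest ≡ 0ℤ
  rest≡0 = [ (λ ()) , (λ eq → eq) ]′ (ℤ.i*j≡0⇒i≡0∨j≡0 (+ M) {rest}
    (trans (sym (ℤ.+-identityˡ (+ M * rest))) (trans (cong (_+ + M * rest) (sym lowest≡0)) split)))
  vanishing : ∀ j → j < suc k → sumℤ (λ i → c i * + δ i j) ≡ 0ℤ
  vanishing zero    _         = lowest≡0
  vanishing (suc j) (s≤s j<k) = digits-vanish c B k (λ i → δ i ∘ suc) (λ i j → δ≤ i (suc j)) rest≡0 j j<k

module _ (t : ℕ) (c : Fin (suc (suc t) ℕ.* 2) → ℤ) (prim : Primitive c) (sum≡0 : sumℤ c ≡ 0ℤ) (c≢0 : 1 ≤ ∥ c ∥)
         (m-1 : ℕ) (sep : Separates (suc t) c prim (suc m-1)) where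

  private
    m M d : ℕ
    m = suc m-1
    M = suc (∥ c ∥ ℕ.* m-1)
    d = suc t ℕ.* 2

  -- Digits start with the first power; the power sum of exponent 0 is the sum of the coefficients,
  -- which is already 0. Digit 0 recovers x < m and makes the code injective.
  digit : ℕ → ℕ → ℕ
  digit x j = ((+ x) ^ suc j) ℤ.%ℕ m

  digit<m : ∀ x j → digit x j < m
  digit<m x j = ℤ.n%ℕd<d ((+ x) ^ suc j) m

  digit<M : ∀ x j → digit x j < M
  digit<M x j = ℕ.<-≤-trans (digit<m x j) (s≤s (ℕ.m≤n*m m-1 ∥ c ∥ {{ℕ.>-nonZero c≢0}}))

  code : ℕ → ℕ
  code x = encode M d (digit x)

  digit-0 : ∀ x → x < m → digit x 0 ≡ x
  digit-0 x x<m = ≋-small⇒≡ (digit<m x 0) x<m (≋-trans (%ℕ-mod _ m) (≋-reflexive (ℤ.*-identityʳ (+ x))))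

  code-injective : ∀ x y → x < m → y < m → code x ≡ code y → x ≡ y
  code-injective x y x<m y<m eq = trans (sym (digit-0 x x<m)) (trans digits (digit-0 y y<m))
    where
    digits : digit x 0 ≡ digit y 0
    digits = ≋-small⇒≡ (digit<M x 0) (digit<M y 0)
      (≋-trans (≋-sym (encode-mod M (suc (t ℕ.* 2)) (digit x)))
        (≋-trans (≋-reflexive (cong +_ eq)) (encode-mod M (suc (t ℕ.* 2)) (digit y))))

  code-solutions-trivial : ∀ (x : Fin (suc (suc t) ℕ.* 2) → ℕ) (y : Fin (suc (suc t) ℕ.* 2) → ℤ) →
    (∀ i → x i < m) → (∀ i → y i ≡ + suc (code (x i))) → linearForm c y ≡ 0ℤ → Trivial c y
  code-solutions-trivial x y x<m y≡ Ly≡0 = constant-on-blocks⇒trivial {c = c} (proj₁ prim) (proj₁ (proj₁ (proj₂ prim))) y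
    λ i k k∈ → trans (y≡ i) (trans (cong (λ z → + suc (code z))
      (≋-small⇒≡ (x<m i) (x<m k) (sep (λ i → + x i) vanish i k k∈))) (sym (y≡ k)))
    where
    lemma : ∀ c z → c * (1ℤ + z) ≡ c * z + 1ℤ * c
    lemma = solve-∀
    -- Elements of the set are codes shifted by 1 into {1, ..., N}; translation invariance removes
    -- the shift.
    codes≡0 : sumℤ (λ i → c i * + code (x i)) ≡ 0ℤ
    codes≡0 = begin
      sumℤ (λ i → c i * + code (x i))
        ≡⟨ sym (ℤ.+-identityʳ _) ⟩
      sumℤ (λ i → c i * + code (x i)) + 1ℤ * 0ℤ
        ≡⟨ cong (λ z → sumℤ (λ i → c i * + code (x i)) + 1ℤ * z) (sym sum≡0) ⟩
      sumℤ (λ i → c i * + code (x i)) + 1ℤ * sumℤ c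
        ≡⟨ sym (sum-linear (λ i → c i * + code (x i)) c 1ℤ) ⟩
      sumℤ (λ i → c i * + code (x i) + 1ℤ * c i)
        ≡⟨ sumℤ-cong (λ i → sym (trans (cong (c i *_) (y≡ i)) (lemma (c i) (+ code (x i))))) ⟩
      linearForm c y
        ≡⟨ Ly≡0 ⟩
      0ℤ ∎
      where open ≡-Reasoning
    vanish : PowerSumsVanish (+ m) d c (λ i → + x i)
    vanish zero    _   = subst (+ m ∣ℤ_) (sym (trans (sumℤ-cong λ i → ℤ.*-identityʳ (c i)) sum≡0)) (divides 0ℤ refl)
    vanish (suc j) j<d = ≋0⇒∣ (≋-trans
      (sum-mod {f = λ i → c i * (+ x i) ^ suc j} {g = λ i → c i * + digit (x i) j}
        λ i → *-modˡ (c i) (≋-sym (%ℕ-mod ((+ x i) ^ suc j) m)))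
      (≋-reflexive (digits-vanish c m-1 d (digit ∘ x) (λ i j → ℕ.s≤s⁻¹ (digit<m (x i) j)) codes≡0 j j<d)))

  r-lower-bound : ∀ N → M ℕ.^ d ≤ N → m ≤ r c N
  r-lower-bound N M^d≤N = ℕ.≤-trans (∣image∣≥ f f-injective) (proj₂ (proj₂ (maxSize c N)) (image f) free)
    where
    code<N : ∀ x → code x < N
    code<N x = ℕ.<-≤-trans (encode< M d (digit x) (digit<M x)) M^d≤N
    f : Fin m → Fin N
    f i = fromℕ< (code<N (toℕ i))
    toℕ-f : ∀ i → toℕ (f i) ≡ code (toℕ i)
    toℕ-f i = Fin.toℕ-fromℕ< (code<N (toℕ i))
    f-injective : ∀ i j → f i ≡ f j → i ≡ j
    f-injective i j eq = Fin.toℕ-injective (code-injective (toℕ i) (toℕ j) (Fin.toℕ<n i) (Fin.toℕ<n j)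
      (trans (sym (toℕ-f i)) (trans (cong toℕ eq) (toℕ-f j))))
    free : LFree c ⟦ image f ⟧
    free y y∈ = code-solutions-trivial (λ i → toℕ (index i)) y (λ i → Fin.toℕ<n (index i)) value
      where
      index : ∀ i → Fin m
      index i = proj₁ (∈-image⁻ f (proj₁ (proj₂ (y∈ i))))
      value : ∀ i → y i ≡ + suc (code (toℕ (index i)))
      value i = trans (proj₂ (proj₂ (y∈ i))) (cong (λ z → + suc z)
        (trans (cong toℕ (sym (proj₂ (∈-image⁻ f (proj₁ (proj₂ (y∈ i))))))) (toℕ-f (index i))))

root : ∀ d N → ∃ λ R → R ℕ.^ suc d ≤ N × N < suc R ℕ.^ suc d
root d zero = 0 , z≤n , ℕ.>-nonZero⁻¹ (1 ℕ.^ suc d) {{ℕ.m^n≢0 1 (suc d)}}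
root d (suc N) with root d N
... | R , R^d≤N , N<[1+R]^d with suc R ℕ.^ suc d ℕ.≤? suc N
... | yes p = suc R , p , ℕ.≤-<-trans N<[1+R]^d (ℕ.^-monoˡ-< (suc d) (ℕ.n<1+n (suc R)))
... | no ¬p = R , ℕ.m≤n⇒m≤1+n R^d≤N , ℕ.≰⇒> ¬p

prod-≢0 : ∀ {n} (c : Fin n → ℤ) → (∀ i → c i ≢ 0ℤ) → prodℤ c ≢ 0ℤ
prod-≢0 {suc n} c c≢0 eq = [ c≢0 zero , prod-≢0 (c ∘ suc) (c≢0 ∘ suc) ]′ (ℤ.i*j≡0⇒i≡0∨j≡0 (c zero) eq)

-- Let R be the integer part of the d-th root of N, S = Σ|cᵢ| and X = R / S. From m ≤ X the base S
-- (m - 1) + 1 is at most R, so the codes fit below N; from X < K m follows R < S K m. Hence T = S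
-- K.
polynomial-lower-bound : ∀ t (c : Fin (suc (suc t) ℕ.* 2) → ℤ) → (∀ i → c i ≢ 0ℤ) → sumℤ c ≡ 0ℤ → Primitive c →
  ¬ IsPerfectSquare (-1ℤ ^ suc (suc t) * prodℤ c) →
  ∃ λ T → 1 ≤ T × ∀ N → 1 ≤ N → N ≤ (T ℕ.* r c N) ℕ.^ (suc t ℕ.* 2)
polynomial-lower-bound t c c≢0 sum≡0 prim nonsquare =
  from-moduli (separating-moduli (suc t) c prim (prod-≢0 c c≢0) nonsquare)
  where
  S d : ℕ
  S = ∥ c ∥
  d = suc t ℕ.* 2
  1≤S : 1 ≤ S
  1≤S = ℕ.≤-trans (ℕ.n≢0⇒n>0 (c≢0 zero ∘ ℤ.∣i∣≡0⇒i≡0)) (∣c∣≤∥c∥ c zero)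
  from-moduli : (∃ λ K → 1 ≤ K × ∀ X → 1 ≤ X → ∃ λ m → Separates (suc t) c prim m × 1 ≤ m × m ≤ X × X < K ℕ.* m) →
                ∃ λ T → 1 ≤ T × ∀ N → 1 ≤ N → N ≤ (T ℕ.* r c N) ℕ.^ d
  from-moduli (K , 1≤K , moduli) = S ℕ.* K , ℕ.*-mono-≤ 1≤S 1≤K , bound
    where
    conclude : ∀ N R m → N < suc R ℕ.^ d → suc R ≤ S ℕ.* K ℕ.* m → m ≤ r c N → N ≤ (S ℕ.* K ℕ.* r c N) ℕ.^ d
    conclude N R m N< R<SKm m≤r = ℕ.≤-trans (ℕ.<⇒≤ N<) (ℕ.^-monoˡ-≤ d (ℕ.≤-trans R<SKm (ℕ.*-monoʳ-≤ (S ℕ.* K) m≤r)))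
    bound : ∀ N → 1 ≤ N → N ≤ (S ℕ.* K ℕ.* r c N) ℕ.^ d
    bound N 1≤N with root (suc (t ℕ.* 2)) N
    ... | R , R^d≤N , N< with S ℕ.≤? R
    -- When R < S the modulus 1 suffices: its base is 1, and a single element already meets the
    -- bound because R + 1 ≤ S K.
    ... | no S≰R = conclude N R 1 N< (ℕ.≤-trans (ℕ.≰⇒> S≰R) (ℕ.≤-trans (ℕ.m≤m*n S K {{ℕ.>-nonZero 1≤K}}) (ℕ.≤-reflexive (sym (ℕ.*-identityʳ (S ℕ.* K))))))
            (r-lower-bound t c prim sum≡0 1≤S 0 (separates-1 (suc t) c prim) N
              (ℕ.≤-trans (ℕ.≤-reflexive (trans (cong (λ z → suc z ℕ.^ d) (ℕ.*-zeroʳ S)) (ℕ.^-zeroˡ d))) 1≤N))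
    ... | yes S≤R = at-scale (moduli X (ℕ.m≥n⇒m/n>0 S≤R))
      where
      instance
        S≢0 : ℕ.NonZero S
        S≢0 = ℕ.>-nonZero 1≤S
      X : ℕ
      X = R / S
      open ℕ.≤-Reasoning
      at-scale : (∃ λ m → Separates (suc t) c prim m × 1 ≤ m × m ≤ X × X < K ℕ.* m) → N ≤ (S ℕ.* K ℕ.* r c N) ℕ.^ d
      at-scale (suc m-1 , sep , _ , m≤X , X<Km) = conclude N R (suc m-1) N< R<SKm
        (r-lower-bound t c prim sum≡0 1≤S m-1 sep N (ℕ.≤-trans (ℕ.^-monoˡ-≤ d M≤R) R^d≤N))
        where
        M≤R : suc (S ℕ.* m-1) ≤ R
        M≤R = begin
          suc (S ℕ.* m-1)      ≤⟨ ℕ.+-monoˡ-≤ (S ℕ.* m-1) 1≤S ⟩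
          S ℕ.+ S ℕ.* m-1      ≡⟨ ℕ.*-suc S m-1 ⟨
          S ℕ.* suc m-1        ≤⟨ ℕ.*-monoʳ-≤ S m≤X ⟩
          S ℕ.* X              ≡⟨ ℕ.*-comm S X ⟩
          X ℕ.* S              ≤⟨ ℕ.m/n*n≤m R S ⟩
          R                    ∎
        R<SKm : suc R ≤ S ℕ.* K ℕ.* suc m-1
        R<SKm = begin-strict
          R                             ≡⟨ ℕ.m≡m%n+[m/n]*n R S ⟩
          R ℕ.% S ℕ.+ X ℕ.* S           <⟨ ℕ.+-monoˡ-< (X ℕ.* S) (ℕ.m%n<n R S) ⟩
          suc X ℕ.* S                   ≤⟨ ℕ.*-monoˡ-≤ S X<Km ⟩
          K ℕ.* suc m-1 ℕ.* S           ≡⟨ lemma K (suc m-1) S ⟩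
          S ℕ.* K ℕ.* suc m-1           ∎
          where
          lemma : ∀ k m s → k ℕ.* m ℕ.* s ≡ s ℕ.* k ℕ.* m
          lemma = ℕSolver.solve-∀

-- The bound over the rationals

fromℕ≡fromℤ : ∀ n → fromℕ n ≡ fromℤ (+ n)
fromℕ≡fromℤ n = ℚ.↥p/↧p≡p (fromℤ (+ n))

fromℕ-* : ∀ a b → fromℕ a ℚ.* fromℕ b ≡ fromℕ (a ℕ.* b)
fromℕ-* a b = trans (cong₂ ℚ._*_ (fromℕ≡fromℤ a) (fromℕ≡fromℤ b)) (cong (ℚ._/ 1) (sym (ℤ.pos-* a b)))

fromℕ-mono-≤ : ∀ {a b} → a ≤ b → fromℕ a ℚ.≤ fromℕ b
fromℕ-mono-≤ {a} {b} a≤b = subst₂ ℚ._≤_ (sym (fromℕ≡fromℤ a)) (sym (fromℕ≡fromℤ b))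
  (ℚ.*≤* (ℤ.*-monoʳ-≤-nonNeg (+ 1) (ℤ.+≤+ a≤b)))

fromℕ-^ : ∀ a d → fromℕ (a ℕ.^ d) ≡ fromℕ a ^ℚ d
fromℕ-^ a zero    = refl
fromℕ-^ a (suc d) = trans (sym (fromℕ-* a (a ℕ.^ d))) (cong (fromℕ a ℚ.*_) (fromℕ-^ a d))

^ℚ-nonNeg : ∀ q .{{_ : ℚ.NonNegative q}} d → ℚ.NonNegative (q ^ℚ d)
^ℚ-nonNeg q zero    = _
^ℚ-nonNeg q (suc d) = ℚ.nonNeg*nonNeg⇒nonNeg q (q ^ℚ d) {{^ℚ-nonNeg q d}}

cancel-power : ∀ {C q} → C ℚ.* q ≡ ℚ.1ℚ → ∀ ρ d → (C ^ℚ d) ℚ.* ((q ℚ.* ρ) ^ℚ d) ≡ ρ ^ℚ d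
cancel-power Cq≡1 ρ zero = refl
cancel-power {C} {q} Cq≡1 ρ (suc d) = begin
  C ℚ.* C ^ℚ d ℚ.* (q ℚ.* ρ ℚ.* (q ℚ.* ρ) ^ℚ d)      ≡⟨ interchange C (C ^ℚ d) (q ℚ.* ρ) ((q ℚ.* ρ) ^ℚ d) ⟩
  C ℚ.* (q ℚ.* ρ) ℚ.* (C ^ℚ d ℚ.* (q ℚ.* ρ) ^ℚ d)    ≡⟨ cong₂ ℚ._*_ (sym (ℚ.*-assoc C q ρ)) (cancel-power Cq≡1 ρ d) ⟩
  C ℚ.* q ℚ.* ρ ℚ.* ρ ^ℚ d                           ≡⟨ cong (λ z → z ℚ.* ρ ℚ.* ρ ^ℚ d) Cq≡1 ⟩
  ℚ.1ℚ ℚ.* ρ ℚ.* ρ ^ℚ d                              ≡⟨ cong (ℚ._* ρ ^ℚ d) (ℚ.*-identityˡ ρ) ⟩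
  ρ ℚ.* ρ ^ℚ d                                       ∎
  where
  open ≡-Reasoning

rational-form : ∀ T d x y → y ≤ (suc T ℕ.* x) ℕ.^ d → x ≥ ℚ.1/ fromℤ (+ suc T) · y ^1/ d
rational-form T d x y y≤ = begin
  (C ^ℚ d) ℚ.* fromℕ y                             ≤⟨ ℚ.*-monoˡ-≤-nonNeg (C ^ℚ d) {{^ℚ-nonNeg C d}} (fromℕ-mono-≤ y≤) ⟩
  (C ^ℚ d) ℚ.* fromℕ ((suc T ℕ.* x) ℕ.^ d)         ≡⟨ cong ((C ^ℚ d) ℚ.*_) expand ⟩
  (C ^ℚ d) ℚ.* ((fromℤ (+ suc T) ℚ.* fromℕ x) ^ℚ d) ≡⟨ cancel-power (ℚ.*-inverseˡ (fromℤ (+ suc T))) (fromℕ x) d ⟩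
  fromℕ x ^ℚ d                                     ∎
  where
  open ℚ.≤-Reasoning
  C : ℚ
  C = ℚ.1/ fromℤ (+ suc T)
  expand : fromℕ ((suc T ℕ.* x) ℕ.^ d) ≡ (fromℤ (+ suc T) ℚ.* fromℕ x) ^ℚ d
  expand = trans (fromℕ-^ (suc T ℕ.* x) d)
    (cong (_^ℚ d) (trans (sym (fromℕ-* (suc T) x)) (cong (ℚ._* fromℕ x) (fromℕ≡fromℤ (suc T)))))

theorem4 : ∀ (s : ℕ) → 3 ≤ s → 2 ∣ s →
    (c : Fin s → ℤ) → (∀ i → c i ≢ 0ℤ) → sumℤ c ≡ 0ℤ → Primitive c →
    ¬ IsPerfectSquare ((-1ℤ ^ (s / 2)) * prodℤ c) →
    ∃ λ (C : ℚ) → Positive C × (∀ (N : ℕ) → 1 ≤ N → r c N ≥ C · N ^1/ (s ∸ 2))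
theorem4 _ 3≤s (∣.divides 0 refl) = contradiction 3≤s λ ()
theorem4 _ 3≤s (∣.divides 1 refl) = contradiction 3≤s λ { (s≤s (s≤s ())) }
-- With s = (t + 2) · 2 the exponent s - 2 computes to (t + 1) · 2; only s / 2 has to be rewritten.
theorem4 _ 3≤s (∣.divides (suc (suc t)) refl) c c≢0 sum≡0 prim nonsquare =
  package (polynomial-lower-bound t c c≢0 sum≡0 prim
    (subst (λ k → ¬ IsPerfectSquare (-1ℤ ^ k * prodℤ c)) (ℕ.m*n/n≡m (suc (suc t)) 2) nonsquare))
  where
  package : (∃ λ T → 1 ≤ T × ∀ N → 1 ≤ N → N ≤ (T ℕ.* r c N) ℕ.^ (suc t ℕ.* 2)) →
            ∃ λ (C : ℚ) → Positive C × (∀ (N : ℕ) → 1 ≤ N → r c N ≥ C · N ^1/ (suc t ℕ.* 2))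
  package (suc T , _ , bound) = ℚ.1/ fromℤ (+ suc T) , _ , λ N 1≤N → rational-form T (suc t ℕ.* 2) (r c N) N (bound N 1≤N)
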